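{- Let $G$ be a connected $4$-regular graph. Then $G$ is not $(3,1)$-colorable if and only if $G$ can be constructed from odd double cycles via a sequence of edge adhesions, i.e., $G$ belongs to the smallest class $\mathcal{C}$ of graphs that contains every odd double cycle and such that whenever $G_1,G_2\in\mathcal{C}$ are vertex-disjoint and $e_1\in E(G_1)$, $e_2\in E(G_2)$, also $(G_1,e_1)+(G_2,e_2)\in\mathcal{C}$.
   Context: All graphs are finite, undirected pseudographs: multiple edges and loops are allowed, and a loop contributes $2$ to the degree of its vertex. An $(r-t,t)$-coloring of an $r$-regular graph is an edge-coloring using at least two colors such that every vertex is incident to exactly $r-t$ edges of one color and exactly $t$ edges of a different color. Edge adhesion: for vertex-disjoint graphs $G_1,G_2$ and edges $e_1=u_1v_1\in E(G_1)$, $e_2=u_2v_2\in E(G_2)$, the graph $(G_1,e_1)+(G_2,e_2)$ has vertex set $V(G_1)\cup V(G_2)\cup\{w\}$ ($w$ a new vertex) and edge set $(E(G_1)\setminus\{e_1\})\cup(E(G_2)\setminus\{e_2\})\cup\{u_1w,v_1w,u_2w,v_2w\}$ (i.e., subdivide $e_1$ and $e_2$ and identify the two subdivision vertices). A double cycle on $n\ge 1$ vertices is obtained from a cycle on $n$ vertices by doubling each edge: for $n\ge3$ this is $C_n$ with every edge replaced by two parallel edges; for $n=2$ it is two vertices joined by four parallel edges; for $n=1$ it is one vertex with two loops. It is odd (even) if $n$ is odd (even). -}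

module Defs where

open import Data.Nat using (ℕ; zero; suc; _+_; _*_; _<_; _≡ᵇ_)
open import Data.Nat.DivMod using (_mod_)
open import Data.Fin using (Fin; zero; suc; toℕ; _↑ˡ_; _↑ʳ_; splitAt; _≟_)
open import Data.Bool using (Bool; true; false; if_then_else_)
open import Data.Product using (Σ; ∃; ∃₂; _×_; _,_; proj₁; proj₂; swap; map)
open import Data.Sum using (_⊎_; inj₁; inj₂)
open import Relation.Nullary using (¬_; yes; no)
open import Relation.Nullary.Decidable using (isYes)
open import Relation.Binary.PropositionalEquality using (_≡_; _≢_)
open import Function.Bundles using (_↔_; Inverse)

-- A finite undirected pseudograph: vertices Fin n, edges Fin m, each edge has
-- an (unordered) pair of endpoints, recorded as an ordered pair; the order is
-- irrelevant in all notions below.  Loops (a , a) and parallel edges allowed.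
record Graph : Set where
  constructor mkGraph
  field
    n    : ℕ
    m    : ℕ
    ends : Fin m → Fin n × Fin n
open Graph public

sumFin : (k : ℕ) → (Fin k → ℕ) → ℕ
sumFin zero    f = 0
sumFin (suc k) f = f zero + sumFin k (λ i → f (suc i))

-- number of ends of an edge equal to v (a loop at v contributes 2)
incid : {k : ℕ} → Fin k → Fin k × Fin k → ℕ
incid v (a , b) = (if isYes (a ≟ v) then 1 else 0) + (if isYes (b ≟ v) then 1 else 0)

deg : (G : Graph) → Fin (n G) → ℕ
deg G v = sumFin (m G) (λ e → incid v (ends G e))

Regular : ℕ → Graph → Set
Regular r G = ∀ v → deg G v ≡ r

data Reach (G : Graph) (u : Fin (n G)) : Fin (n G) → Set where
  here  : Reach G u u
  stepF : ∀ {v} → Reach G u v → (e : Fin (m G)) → proj₁ (ends G e) ≡ v → Reach G u (proj₂ (ends G e))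
  stepB : ∀ {v} → Reach G u v → (e : Fin (m G)) → proj₂ (ends G e) ≡ v → Reach G u (proj₁ (ends G e))

Connected : Graph → Set
Connected G = (0 < n G) × (∀ u v → Reach G u v)

degC : (G : Graph) → (Fin (m G) → ℕ) → ℕ → Fin (n G) → ℕ
degC G c col v = sumFin (m G) (λ e → if c e ≡ᵇ col then incid v (ends G e) else 0)

-- (p,q)-colouring (p = r - t, q = t): at least two colours used, and every vertex
-- is incident to exactly p edges of one colour and exactly q of a different colour.
IsColoring : ℕ → ℕ → (G : Graph) → (Fin (m G) → ℕ) → Set
IsColoring p q G c =
  (∃₂ λ e e' → c e ≢ c e') ×
  (∀ v → ∃₂ λ x y → x ≢ y × degC G c x v ≡ p × degC G c y v ≡ q)

Colorable : ℕ → ℕ → Graph → Set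
Colorable p q G = Σ (Fin (m G) → ℕ) (IsColoring p q G)

SameEnds : {k : ℕ} → Fin k × Fin k → Fin k × Fin k → Set
SameEnds p q = p ≡ q ⊎ p ≡ swap q

record Iso (G H : Graph) : Set where
  field
    vmap : Fin (n G) ↔ Fin (n H)
    emap : Fin (m G) ↔ Fin (m H)
    ends-pres : ∀ e → SameEnds (ends H (Inverse.to emap e))
                               (map (Inverse.to vmap) (Inverse.to vmap) (ends G e))

doubleCycle : ℕ → Graph
doubleCycle j = mkGraph (suc j) (suc j + suc j) e
  where
  nxt : Fin (suc j) → Fin (suc j)
  nxt i = suc (toℕ i) mod (suc j)
  e : Fin (suc j + suc j) → Fin (suc j) × Fin (suc j)
  e x with splitAt (suc j) x
  ... | inj₁ i = i , nxt i
  ... | inj₂ i = i , nxt i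

-- edge adhesion (G₁,e₁)+(G₂,e₂).  New vertex w = zero; the edge e₁ = u₁v₁ is
-- replaced (in place) by u₁w, and e₂ = u₂v₂ by u₂w; two new edges v₁w, v₂w are added.
-- (Up to isomorphism this is exactly the construction of the paper.)
adhesion : (G₁ : Graph) → Fin (m G₁) → (G₂ : Graph) → Fin (m G₂) → Graph
adhesion G₁ e₁ G₂ e₂ = mkGraph (suc (n G₁ + n G₂)) (2 + (m G₁ + m G₂)) E
  where
  N = suc (n G₁ + n G₂)
  w : Fin N
  w = zero
  i₁ : Fin (n G₁) → Fin N
  i₁ x = suc (x ↑ˡ n G₂)
  i₂ : Fin (n G₂) → Fin N
  i₂ y = suc (n G₁ ↑ʳ y)
  E : Fin (2 + (m G₁ + m G₂)) → Fin N × Fin N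
  E zero = i₁ (proj₂ (ends G₁ e₁)) , w
  E (suc zero) = i₂ (proj₂ (ends G₂ e₂)) , w
  E (suc (suc k)) with splitAt (m G₁) k
  ... | inj₁ e = if isYes (e ≟ e₁) then (i₁ (proj₁ (ends G₁ e₁)) , w)
                 else map i₁ i₁ (ends G₁ e)
  ... | inj₂ e = if isYes (e ≟ e₂) then (i₂ (proj₁ (ends G₂ e₂)) , w)
                 else map i₂ i₂ (ends G₂ e)

data InC : Graph → Set where
  oddDC : (j : ℕ) → InC (doubleCycle (2 * j))
  adh   : ∀ {G₁ G₂} → InC G₁ → InC G₂ → (e₁ : Fin (m G₁)) → (e₂ : Fin (m G₂)) →
          InC (adhesion G₁ e₁ G₂ e₂)
  iso   : ∀ {G H} → InC G → Iso G H → InC H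

{-# OPTIONS --safe #-}
module Submission where

-- Over 𝔽₂, either prescribed vertex parities are realised by an edge set, or some
-- closed vertex set meets them oddly.  Hence a graph of even order splits into two
-- colours with all degrees odd.  Let the order be odd.  If f = uv is the only edge
-- between u and v, colour f alone with a third colour, the other edges at u with the
-- first and those at v with the second, and complete by parities.  This fails only if
-- {u, v} separates G, and then counting edges leaves either a colouring or a cut
-- vertex w with odd sides, where G is an adhesion of two smaller odd graphs G₁ and G₂.
-- In an odd Gᵢ the two halves of the subdivided edge can always be coloured
-- differently, so a colouring of either part extends to G.  If every edge that is not
-- a loop has a parallel one, then again there is such a cut vertex or G is a double
-- cycle.  Conversely, at the vertex created by an adhesion one of the two pairs of
-- edges is monochromatic, and mixed and monochromatic pairs of parallel edges
-- alternate around a double cycle.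

open import Defs
open import Algebra.Bundles using (CommutativeMonoid; CommutativeRing)
import Algebra.Properties.CommutativeMonoid.Sum as Summation
import Algebra.Properties.CommutativeSemigroup as CommutativeSemigroup
open import Data.Bool using (Bool; true; false; not; _∧_; _∨_; _xor_; if_then_else_; T)
import Data.Bool.Properties as Bool
open import Data.Bool.Properties
  using ( xor-∧-commutativeRing; xor-comm; xor-same; xor-identityʳ; ∧-distribˡ-xor; ∧-distribʳ-xor; xor-annihilates-not
        ; ∧-comm; ∧-assoc; ∧-zeroʳ; ∧-identityʳ; ∨-zeroʳ; not-involutive; ¬-not; if-eta)
open import Data.Fin using (Fin; zero; suc; toℕ; fromℕ; fromℕ<; inject₁; _↑ˡ_; _↑ʳ_; splitAt; _≟_)
import Data.Fin.Permutation as Perm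
import Data.Fin.Properties as Fin
open import Data.Fin.Properties
  using (any?; all?; ↑ˡ-injective; ↑ʳ-injective; splitAt-↑ˡ; splitAt-↑ʳ; splitAt⁻¹-↑ˡ; splitAt⁻¹-↑ʳ)
open import Data.Nat using (ℕ; zero; suc; _+_; _*_; _≤_; _<_; z≤n; s≤s; s≤s⁻¹; _≡ᵇ_)
import Data.Nat as Nat
open import Data.Nat.DivMod using (_mod_; _%_; m<n⇒m%n≡m; n%n≡0)
open import Data.Nat.Induction using (<-wellFounded)
open import Data.Nat.Properties
  using ( +-0-commutativeMonoid; +-commutativeSemigroup; +-identityʳ; +-assoc; +-comm; +-suc; suc-injective; +-cancelʳ-≡; 1+n≢n
        ; ≤-refl; ≤-trans; ≤-reflexive; +-mono-≤; m≤m+n; m≤n+m; _≤?_; ≰⇒>; <⇒≱; <⇒≢; <-irrefl; <-trans; n<1+n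
        ; m<n⇒m<1+n; m≤n⇒m<n∨m≡n; m<1+n⇒m<n∨m≡n; n≢0⇒n>0; ≡ᵇ⇒≡; module ≤-Reasoning)
open import Data.Product using (Σ; ∃; ∃₂; _×_; _,_; proj₁; proj₂; map)
open import Data.Product.Properties using (≡-dec)
import Data.Sum as Sum
open import Data.Sum using (_⊎_; inj₁; inj₂; fromInj₁; fromInj₂; [_,_]′)
import Data.Vec.Functional as Vector
open import Function using (_∘_)
open import Function.Bundles using (_⇔_; mk⇔; _↔_; Inverse; mk↔ₛ′)
import Function.Properties.Inverse as Inv
open import Induction.WellFounded using (Acc; acc)
open import Relation.Binary.PropositionalEquality
  using (_≡_; _≢_; refl; sym; trans; cong; cong₂; subst; module ≡-Reasoning)
open import Relation.Nullary using (¬_; Dec; yes; no; contradiction)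
open import Relation.Nullary.Decidable using (isYes; _⊎-dec_; _×-dec_; _→-dec_; ¬?)

-- With two colours only, each colour class would have odd degree everywhere, which an odd order
-- forbids; hence the third colour on a single edge `f`. When the completion fails, linear algebra
-- returns an `Obstruction`: a union `A` of components of `G - u - v` of the wrong parity. As the
-- order is odd and `f` is single, the vertices outside `A`, `u` and `v` form a second obstruction,
-- and besides `f` each of `u` and `v` has only three ends to share between the two. So one of them
-- is left by at most three edges, hence by two or none, since all cuts are even. If these edges
-- meet only one of `u` and `v`, there is an odd cut. The obstacle is one edge at each: the set is
-- then even and shows no odd cut by itself. The single-edge colouring is attempted again at one of
-- these two edges, and the second obstruction breaks along the even set into two pieces, each
-- attached at one vertex, one of them odd. The alternatives are kept as disjunctions, so
-- colourability never has to be decided. Connectedness is used as `Linked`, because the parts of an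
-- adhesion inherit it by extending vertex sets instead of rerouting paths.

private
  module Sumℕ = Summation +-0-commutativeMonoid
  module Xor = Summation (CommutativeRing.+-commutativeMonoid xor-∧-commutativeRing)
  open CommutativeSemigroup +-commutativeSemigroup using () renaming (interchange to +-interchange)
  open CommutativeSemigroup (CommutativeMonoid.commutativeSemigroup (CommutativeRing.+-commutativeMonoid xor-∧-commutativeRing))
    using () renaming (interchange to xor-interchange)

-- Finite sums

infix 7 _==_

_==_ : ∀ {k} → Fin k → Fin k → Bool
i == j = isYes (i ≟ j)

==-refl : ∀ {k} (i : Fin k) → (i == i) ≡ true
==-refl i with i ≟ i
... | yes _ = refl
... | no i≢i = contradiction refl i≢i

==-≢ : ∀ {k} {i j : Fin k} → i ≢ j → (i == j) ≡ false
==-≢ {i = i} {j} i≢j with i ≟ j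
... | yes i≡j = contradiction i≡j i≢j
... | no _ = refl

==⇒≡ : ∀ {k} {i j : Fin k} → (i == j) ≡ true → i ≡ j
==⇒≡ {i = i} {j} p with yes i≡j ← i ≟ j = i≡j

==-sym : ∀ {k} (i j : Fin k) → (i == j) ≡ (j == i)
==-sym i j with i ≟ j
... | yes refl = sym (==-refl i)
... | no i≢j = sym (==-≢ (i≢j ∘ sym))

==-suc : ∀ {k} (i j : Fin k) → (suc i == suc j) ≡ (i == j)
==-suc i j with i ≟ j
... | yes _ = refl
... | no _ = refl

bit : Bool → ℕ
bit b = if b then 1 else 0

sumFin-cong : ∀ k {f g : Fin k → ℕ} → (∀ i → f i ≡ g i) → sumFin k f ≡ sumFin k g
sumFin-cong zero    f≗g = refl
sumFin-cong (suc k) f≗g = cong₂ _+_ (f≗g zero) (sumFin-cong k (f≗g ∘ suc))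

sumFin≡sum : ∀ k (f : Fin k → ℕ) → sumFin k f ≡ Sumℕ.sum f
sumFin≡sum zero    f = refl
sumFin≡sum (suc k) f = cong (f zero +_) (sumFin≡sum k (f ∘ suc))

sumFin-+ : ∀ k (f g : Fin k → ℕ) → sumFin k (λ i → f i + g i) ≡ sumFin k f + sumFin k g
sumFin-+ k f g = begin
  sumFin k (λ i → f i + g i)  ≡⟨ sumFin≡sum k _ ⟩
  Sumℕ.sum (λ i → f i + g i)  ≡⟨ Sumℕ.∑-distrib-+ f g ⟩
  Sumℕ.sum f + Sumℕ.sum g     ≡⟨ cong₂ _+_ (sumFin≡sum k f) (sumFin≡sum k g) ⟨
  sumFin k f + sumFin k g     ∎
  where open ≡-Reasoning

sumFin-permute : ∀ {k l} (π : Fin k ↔ Fin l) (f : Fin l → ℕ) → sumFin l f ≡ sumFin k (f ∘ Inverse.to π)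
sumFin-permute {k} {l} π f = trans (sumFin≡sum l f) (trans (Sumℕ.sum-permute f π) (sym (sumFin≡sum k _)))

sumFin-0 : ∀ k → sumFin k (λ _ → 0) ≡ 0
sumFin-0 zero    = refl
sumFin-0 (suc k) = sumFin-0 k

sumFin-single : ∀ k (j : Fin k) (f : Fin k → ℕ) →
                sumFin k (λ i → if i == j then f i else 0) ≡ f j
sumFin-single (suc k) zero    f = trans (cong (f zero +_) (sumFin-0 k)) (+-identityʳ _)
sumFin-single (suc k) (suc j) f =
  trans (sumFin-cong k λ i → cong (λ b → if b then f (suc i) else 0) (==-suc i j))
        (sumFin-single k j (f ∘ suc))

sumFin-↑ : ∀ k l (f : Fin (k + l) → ℕ) →
           sumFin (k + l) f ≡ sumFin k (λ i → f (i ↑ˡ l)) + sumFin l (λ i → f (k ↑ʳ i))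
sumFin-↑ zero    l f = refl
sumFin-↑ (suc k) l f =
  trans (cong (f zero +_) (sumFin-↑ k l (f ∘ suc))) (sym (+-assoc (f zero) _ _))

sumFin-mono : ∀ k {f g : Fin k → ℕ} → (∀ i → f i ≤ g i) → sumFin k f ≤ sumFin k g
sumFin-mono zero    f≤g = z≤n
sumFin-mono (suc k) f≤g = +-mono-≤ (f≤g zero) (sumFin-mono k (f≤g ∘ suc))

≤∧sum≡⇒≡ : ∀ {a b c d} → a ≤ b → c ≤ d → a + c ≡ b + d → a ≡ b × c ≡ d
≤∧sum≡⇒≡ {b = b} z≤n c≤d eq with b
... | zero  = refl , eq
... | suc b = contradiction (≤-trans (≤-reflexive (sym eq)) c≤d) λ le →
                contradiction (≤-trans (s≤s (m≤n+m _ b)) le) (<-irrefl refl)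
≤∧sum≡⇒≡ (s≤s a≤b) c≤d eq with refl , c≡d ← ≤∧sum≡⇒≡ a≤b c≤d (suc-injective eq) = refl , c≡d

-- Turns a tight count into information about every single edge: used for the four ends at the apex
-- of an odd cut and for the four edges at a vertex with two neighbours.
sumFin-mono-≡ : ∀ k {f g : Fin k → ℕ} → (∀ i → f i ≤ g i) → sumFin k f ≡ sumFin k g → ∀ i → f i ≡ g i
sumFin-mono-≡ (suc k) f≤g eq i with f₀ , f₊ ← ≤∧sum≡⇒≡ (f≤g zero) (sumFin-mono k (f≤g ∘ suc)) eq with i
... | zero  = f₀
... | suc j = sumFin-mono-≡ k (f≤g ∘ suc) f₊ j

sumFin≡0 : ∀ k {f : Fin k → ℕ} → sumFin k f ≡ 0 → ∀ i → f i ≡ 0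
sumFin≡0 k Σf≡0 i = sym (sumFin-mono-≡ k (λ _ → z≤n) (trans (sumFin-0 k) (sym Σf≡0)) i)

count : ∀ {k} → (Fin k → Bool) → ℕ
count {k} P = sumFin k (bit ∘ P)

true≢false : ∀ {b} → b ≡ true → b ≢ false
true≢false refl ()

count-remove : ∀ {k} (P : Fin k → Bool) {i} → P i ≡ true →
               count P ≡ suc (count (λ j → P j ∧ not (j == i)))
count-remove {k} P {i} Pi = begin
  count P
    ≡⟨ sumFin-cong k split ⟩
  sumFin k (λ j → (if j == i then 1 else 0) + bit (P j ∧ not (j == i)))
    ≡⟨ sumFin-+ k _ _ ⟩
  sumFin k (λ j → if j == i then 1 else 0) + count (λ j → P j ∧ not (j == i))
    ≡⟨ cong (_+ count (λ j → P j ∧ not (j == i))) (sumFin-single k i (λ _ → 1)) ⟩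
  suc (count (λ j → P j ∧ not (j == i)))
    ∎
  where
  open ≡-Reasoning
  split : ∀ j → bit (P j) ≡ (if j == i then 1 else 0) + bit (P j ∧ not (j == i))
  split j with j ≟ i
  ... | yes refl rewrite Pi = refl
  ... | no _ rewrite ∧-identityʳ (P j) = refl

count-suc : ∀ {k} (P : Fin k → Bool) {c} → count P ≡ suc c →
            ∃ λ i → P i ≡ true × count (λ j → P j ∧ not (j == i)) ≡ c
count-suc {k} P eq with any? (λ i → P i Bool.≟ true)
... | yes (i , Pi) = i , Pi , suc-injective (trans (sym (count-remove P Pi)) eq)
... | no ¬P = contradiction (trans (sym eq) (trans (sumFin-cong k (λ i → cong bit (¬-not (λ Pi → ¬P (i , Pi))))) (sumFin-0 k))) λ ()

count≡0 : ∀ {k} (P : Fin k → Bool) → count P ≡ 0 → ∀ i → P i ≡ false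
count≡0 {k} P eq i with P i in Pi | sumFin≡0 k eq i
... | false | _ = refl
... | true  | ()

count≡1 : ∀ {k} (P : Fin k → Bool) → count P ≡ 1 →
          ∃ λ i → P i ≡ true × (∀ j → P j ≡ true → j ≡ i)
count≡1 P eq with i , Pi , rest ← count-suc P eq = i , Pi , unique
  where
  unique : ∀ j → P j ≡ true → j ≡ i
  unique j Pj with j ≟ i | count≡0 _ rest j
  ... | yes j≡i | _ = j≡i
  ... | no _ | none rewrite Pj = contradiction none λ ()

count≡2 : ∀ {k} (P : Fin k → Bool) → count P ≡ 2 →
          ∃₂ λ i j → i ≢ j × P i ≡ true × P j ≡ true × (∀ l → P l ≡ true → l ≡ i ⊎ l ≡ j)
count≡2 P eq with i , Pi , rest ← count-suc P eq with j , Pj∖i , unique ← count≡1 _ rest =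
  i , j , (λ i≡j → distinct (sym i≡j)) , Pi , Pj , only
  where
  distinct : j ≢ i
  distinct refl rewrite ==-refl j | ∧-zeroʳ (P j) = contradiction Pj∖i λ ()
  Pj : P j ≡ true
  Pj with true ← P j = refl
  only : ∀ l → P l ≡ true → l ≡ i ⊎ l ≡ j
  only l Pl with l ≟ i | unique l
  ... | yes l≡i | _ = inj₁ l≡i
  ... | no _ | uniq rewrite Pl = inj₂ (uniq refl)

odd : ℕ → Bool
odd zero    = false
odd (suc k) = not (odd k)

odd-+ : ∀ k l → odd (k + l) ≡ odd k xor odd l
odd-+ zero    l = refl
odd-+ (suc k) l rewrite odd-+ k l with odd k
... | true  = not-involutive _
... | false = refl

odd-bit : ∀ b → odd (bit b) ≡ b
odd-bit true  = refl
odd-bit false = refl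

-- Opacity makes ⨁ injective for unification, so that its argument can be inferred.
opaque
  ⨁ : ∀ {k} → (Fin k → Bool) → Bool
  ⨁ = Xor.sum

  ⨁-cong : ∀ {k} {f g : Fin k → Bool} → (∀ i → f i ≡ g i) → ⨁ f ≡ ⨁ g
  ⨁-cong = Xor.sum-cong-≗

  ⨁-xor : ∀ {k} (f g : Fin k → Bool) → ⨁ (λ i → f i xor g i) ≡ ⨁ f xor ⨁ g
  ⨁-xor = Xor.∑-distrib-+

  ⨁-comm : ∀ {k l} (f : Fin k → Fin l → Bool) → ⨁ (λ i → ⨁ (f i)) ≡ ⨁ (λ j → ⨁ (λ i → f i j))
  ⨁-comm = Xor.∑-comm

  ⨁-false : ∀ {k} {f : Fin k → Bool} → (∀ i → f i ≡ false) → ⨁ f ≡ false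
  ⨁-false {k} f≡false = trans (⨁-cong f≡false) (Xor.sum-replicate-zero k)

  ⨁-empty : (f : Fin 0 → Bool) → ⨁ f ≡ false
  ⨁-empty f = refl

  ⨁-suc : ∀ {k} (f : Fin (suc k) → Bool) → ⨁ f ≡ f zero xor ⨁ (f ∘ suc)
  ⨁-suc f = refl

  ∧-⨁ : ∀ {k} b (f : Fin k → Bool) → b ∧ ⨁ f ≡ ⨁ (λ i → b ∧ f i)
  ∧-⨁ true  f = refl
  ∧-⨁ {k} false f = sym (⨁-false {k} λ _ → refl)

  ⨁-single : ∀ {k} (f : Fin k → Bool) j → ⨁ (λ i → f i ∧ (j == i)) ≡ f j
  ⨁-single {suc k} f zero =
    trans (cong₂ _xor_ (∧-identityʳ (f zero)) (⨁-false {k} λ i → ∧-zeroʳ (f (suc i)))) (xor-identityʳ _)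
  ⨁-single {suc k} f (suc j) =
    trans (cong₂ _xor_ (∧-zeroʳ (f zero)) (⨁-cong λ i → cong (f (suc i) ∧_) (==-suc j i)))
          (⨁-single (f ∘ suc) j)

  ⨁-true : ∀ k → ⨁ {k} (λ _ → true) ≡ odd k
  ⨁-true zero    = refl
  ⨁-true (suc k) = cong not (⨁-true k)

  odd-sumFin : ∀ k (f : Fin k → ℕ) → odd (sumFin k f) ≡ ⨁ (odd ∘ f)
  odd-sumFin zero    f = refl
  odd-sumFin (suc k) f = trans (odd-+ (f zero) _) (cong (odd (f zero) xor_) (odd-sumFin k (f ∘ suc)))

⨁-== : ∀ {k} (j : Fin k) → ⨁ (λ i → i == j) ≡ true
⨁-== j = trans (⨁-cong λ i → ==-sym i j) (⨁-single (λ _ → true) j)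

odd-count : ∀ {k} (P : Fin k → Bool) → odd (count P) ≡ ⨁ P
odd-count {k} P = trans (odd-sumFin k _) (⨁-cong λ i → odd-bit (P i))

-- The Fredholm alternative over 𝔽₂

xor-solve : ∀ {x y b} → x xor y ≡ true → y ≡ b → x ≡ not b
xor-solve {true}  {false} _ refl = refl
xor-solve {false} {true}  _ refl = refl

⨁-∧-xorˡ : ∀ {k} (A B f : Fin k → Bool) →
           ⨁ (λ i → (A i xor B i) ∧ f i) ≡ ⨁ (λ i → A i ∧ f i) xor ⨁ (λ i → B i ∧ f i)
⨁-∧-xorˡ A B f = trans (⨁-cong λ i → ∧-distribʳ-xor (f i) (A i) (B i)) (⨁-xor _ _)

⨁-∧-xorʳ : ∀ {k} (A f g : Fin k → Bool) →
           ⨁ (λ i → A i ∧ (f i xor g i)) ≡ ⨁ (λ i → A i ∧ f i) xor ⨁ (λ i → A i ∧ g i)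
⨁-∧-xorʳ A f g = trans (⨁-cong λ i → ∧-distribˡ-xor (A i) (f i) (g i)) (⨁-xor _ _)

-- Induction on the rows. If the remaining rows span neither `T` nor `T` plus the first row, with
-- certificates `A` and `B`, then one of `A`, `B` and their sum is orthogonal to the first row too
-- and still pairs to `true` with `T`.
fredholm : ∀ {m n} (M : Fin m → Fin n → Bool) (T : Fin n → Bool) →
           (Σ (Fin m → Bool) λ F → ∀ v → ⨁ (λ e → F e ∧ M e v) ≡ T v) ⊎
           (Σ (Fin n → Bool) λ A → (∀ e → ⨁ (λ v → A v ∧ M e v) ≡ false) × ⨁ (λ v → A v ∧ T v) ≡ true)
fredholm {zero} M T with any? (λ v → T v Bool.≟ true)
... | yes (v , Tv) = inj₂ ((λ x → v == x) , (λ ()) ,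
                           trans (⨁-cong λ x → ∧-comm (v == x) (T x)) (trans (⨁-single T v) Tv))
... | no ¬T = inj₁ ((λ ()) , λ v → trans (⨁-empty _) (sym (¬-not λ Tv → ¬T (v , Tv))))
fredholm {suc m} M T with fredholm (M ∘ suc) T
... | inj₁ (F , ∂F≡T) = inj₁ ((λ { zero → false ; (suc e) → F e }) , λ v → trans (⨁-suc _) (∂F≡T v))
... | inj₂ (A , A⊥ , A·T) with fredholm (M ∘ suc) (λ v → T v xor M zero v)
...   | inj₁ (F , ∂F≡) = inj₁ ((λ { zero → true ; (suc e) → F e }) , λ v → trans (⨁-suc _) (sums v))
  where
  cancel : ∀ a b → a xor (b xor a) ≡ b
  cancel true  true  = refl
  cancel true  false = refl
  cancel false true  = refl
  cancel false false = refl
  sums : ∀ v → M zero v xor ⨁ (λ e → F e ∧ M (suc e) v) ≡ T v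
  sums v = trans (cong (M zero v xor_) (∂F≡ v)) (cancel (M zero v) (T v))
...   | inj₂ (B , B⊥ , B·T) with ⨁ (λ v → A v ∧ M zero v) in A₀ | ⨁ (λ v → B v ∧ M zero v) in B₀
...     | false | _     = inj₂ (A , (λ { zero → A₀ ; (suc e) → A⊥ e }) , A·T)
...     | true  | false = inj₂ (B , (λ { zero → B₀ ; (suc e) → B⊥ e }) , B·T′)
  where
  B·T′ : ⨁ (λ v → B v ∧ T v) ≡ true
  B·T′ = xor-solve (trans (sym (⨁-∧-xorʳ B T (M zero))) B·T) B₀
...     | true  | true  = inj₂ ((λ v → A v xor B v) , ⊥AB , AB·T)
  where
  ⊥AB : ∀ e → ⨁ (λ v → (A v xor B v) ∧ M e v) ≡ false
  ⊥AB zero    = trans (⨁-∧-xorˡ A B (M zero)) (cong₂ _xor_ A₀ B₀)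
  ⊥AB (suc e) = trans (⨁-∧-xorˡ A B (M (suc e))) (cong₂ _xor_ (A⊥ e) (B⊥ e))
  B·T′ : ⨁ (λ v → B v ∧ T v) ≡ false
  B·T′ = xor-solve (trans (sym (⨁-∧-xorʳ B T (M zero))) B·T) B₀
  AB·T : ⨁ (λ v → (A v xor B v) ∧ T v) ≡ true
  AB·T = trans (⨁-∧-xorˡ A B T) (cong₂ _xor_ A·T B·T′)

-- Enumeration of decidable subsets

-- Relabels a subset by an initial segment of the numbers, so that it can serve as the vertex or
-- edge set of a `Graph`.
record Enumeration {n : ℕ} (P : Fin n → Bool) : Set where
  field
    size      : ℕ
    elem      : Fin size → Fin n
    sound     : ∀ i → P (elem i) ≡ true
    injective : ∀ {i j} → elem i ≡ elem j → i ≡ j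
    complete  : ∀ x → P x ≡ true → ∃ λ i → elem i ≡ x
    size≡     : size ≡ count P

enumerate : ∀ {n} (P : Fin n → Bool) → Enumeration P
enumerate {zero} P = record
  { size = 0 ; elem = λ () ; sound = λ () ; injective = λ { {()} } ; complete = λ () ; size≡ = refl }
enumerate {suc n} P with enumerate (P ∘ suc) | P zero in P₀
... | E | false = record
  { size = size ; elem = suc ∘ elem ; sound = sound
  ; injective = λ eq → injective (Fin.suc-injective eq)
  ; complete = λ { zero P₀′ → contradiction P₀ (true≢false P₀′)
                 ; (suc x) Px → let i , eq = complete x Px in i , cong suc eq }
  ; size≡ = trans size≡ (cong (λ b → bit b + count (P ∘ suc)) (sym P₀)) }
  where open Enumeration E
... | E | true = record
  { size = suc size ; elem = λ { zero → zero ; (suc i) → suc (elem i) }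
  ; sound = λ { zero → P₀ ; (suc i) → sound i }
  ; injective = λ { {zero} {zero} _ → refl ; {suc i} {suc j} eq → cong suc (injective (Fin.suc-injective eq)) }
  ; complete = λ { zero _ → zero , refl ; (suc x) Px → let i , eq = complete x Px in suc i , cong suc eq }
  ; size≡ = trans (cong suc size≡) (cong (λ b → bit b + count (P ∘ suc)) (sym P₀)) }
  where open Enumeration E

-- Weighted degrees and cuts

-- The coboundary of `A` over 𝔽₂, evaluated at an edge; a loop always gives `false`.
cross : ∀ {k} → (Fin k → Bool) → Fin k × Fin k → Bool
cross A (a , b) = A a xor A b

touches : ∀ {k} → Fin k → Fin k × Fin k → Bool
touches v (a , b) = (a == v) ∨ (b == v)

-- Both `deg` and `degC` are definitionally instances, so that facts about degrees are proved once.
wdeg : (G : Graph) → (Fin (m G) → Bool) → Fin (n G) → ℕ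
wdeg G S v = sumFin (m G) (λ e → if S e then incid v (ends G e) else 0)

-- Connectedness in dual form: every nontrivial vertex set is left by some edge.
Linked : Graph → Set
Linked G = ∀ A → (∀ e → cross A (ends G e) ≡ false) → ∀ u v → A u ≡ A v

xor≡false⇒≡ : ∀ {a b} → a xor b ≡ false → a ≡ b
xor≡false⇒≡ {true}  {true}  _ = refl
xor≡false⇒≡ {false} {false} _ = refl

connected⇒linked : ∀ G → Connected G → Linked G
connected⇒linked G (_ , reach) A closed u v = go (reach u v)
  where
  go : ∀ {v} → Reach G u v → A u ≡ A v
  go here = refl
  go (stepF r e refl) = trans (go r) (xor≡false⇒≡ (closed e))
  go (stepB r e refl) = trans (go r) (sym (xor≡false⇒≡ (closed e)))

-- Agreement is asked only at edges incident with `v`, because the colourings below are described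
-- differently near different vertices.
wdeg-cong : ∀ G {S S′ : Fin (m G) → Bool} v → (∀ e → incid v (ends G e) ≢ 0 → S e ≡ S′ e) →
            wdeg G S v ≡ wdeg G S′ v
wdeg-cong G {S} {S′} v eq = sumFin-cong (m G) pointwise
  where
  pointwise : ∀ e → (if S e then incid v (ends G e) else 0) ≡ (if S′ e then incid v (ends G e) else 0)
  pointwise e with incid v (ends G e) | eq e
  ... | zero  | _ = trans (if-eta (S e)) (sym (if-eta (S′ e)))
  ... | suc k | S≡S′ rewrite S≡S′ (λ ()) = refl

wdeg-disjoint : ∀ G {S S₁ S₂ : Fin (m G) → Bool} → (∀ e → bit (S e) ≡ bit (S₁ e) + bit (S₂ e)) →
                ∀ v → wdeg G S v ≡ wdeg G S₁ v + wdeg G S₂ v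
wdeg-disjoint G {S} {S₁} {S₂} eq v =
  trans (sumFin-cong (m G) λ e → pointwise (incid v (ends G e)) (S e) (S₁ e) (S₂ e) (eq e)) (sumFin-+ (m G) _ _)
  where
  pointwise : ∀ x s s₁ s₂ → bit s ≡ bit s₁ + bit s₂ →
              (if s then x else 0) ≡ (if s₁ then x else 0) + (if s₂ then x else 0)
  pointwise x true  true  false _ = sym (+-identityʳ x)
  pointwise x true  false true  _ = refl
  pointwise x false false false _ = refl

wdeg-complement : ∀ G S v → deg G v ≡ wdeg G S v + wdeg G (not ∘ S) v
wdeg-complement G S = wdeg-disjoint G {λ _ → true} (λ e → complement (S e))
  where
  complement : ∀ b → 1 ≡ bit b + bit (not b)
  complement true  = refl
  complement false = refl

odd-incid : ∀ {k} (v : Fin k) p → odd (incid v p) ≡ cross (_== v) p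
odd-incid v (a , b) = trans (odd-+ (bit (a == v)) _) (cong₂ _xor_ (odd-bit (a == v)) (odd-bit (b == v)))

odd-wdeg : ∀ G S v → odd (wdeg G S v) ≡ ⨁ (λ e → S e ∧ cross (_== v) (ends G e))
odd-wdeg G S v = trans (odd-sumFin (m G) _) (⨁-cong pointwise)
  where
  pointwise : ∀ e → odd (if S e then incid v (ends G e) else 0) ≡ S e ∧ cross (_== v) (ends G e)
  pointwise e with S e
  ... | true  = odd-incid v (ends G e)
  ... | false = refl

⨁-cross : ∀ {k} (A : Fin k → Bool) s p → ⨁ (λ v → A v ∧ (s ∧ cross (_== v) p)) ≡ s ∧ cross A p
⨁-cross A s (a , b) = begin
  ⨁ (λ v → A v ∧ (s ∧ ((a == v) xor (b == v))))        ≡⟨ ⨁-cong (λ v → pull (A v) s _) ⟩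
  ⨁ (λ v → s ∧ (A v ∧ ((a == v) xor (b == v))))        ≡⟨ ∧-⨁ s _ ⟨
  s ∧ ⨁ (λ v → A v ∧ ((a == v) xor (b == v)))          ≡⟨ cong (s ∧_) (⨁-∧-xorʳ A (a ==_) (b ==_)) ⟩
  s ∧ (⨁ (λ v → A v ∧ (a == v)) xor ⨁ (λ v → A v ∧ (b == v)))
    ≡⟨ cong (s ∧_) (cong₂ _xor_ (⨁-single A a) (⨁-single A b)) ⟩
  s ∧ (A a xor A b)                                    ∎
  where
  open ≡-Reasoning
  pull : ∀ x y z → x ∧ (y ∧ z) ≡ y ∧ (x ∧ z)
  pull true  y z = refl
  pull false true z = refl
  pull false false z = refl

-- Double counting: an edge of `S` inside `A` contributes two ends, which cancel, and an edge
-- leaving `A` contributes one.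
⨁-∧-odd-wdeg : ∀ G A S → ⨁ (λ v → A v ∧ odd (wdeg G S v)) ≡ ⨁ (λ e → S e ∧ cross A (ends G e))
⨁-∧-odd-wdeg G A S = begin
  ⨁ (λ v → A v ∧ odd (wdeg G S v))                               ≡⟨ ⨁-cong (λ v → cong (A v ∧_) (odd-wdeg G S v)) ⟩
  ⨁ (λ v → A v ∧ ⨁ (λ e → S e ∧ cross (_== v) (ends G e)))       ≡⟨ ⨁-cong (λ v → ∧-⨁ (A v) _) ⟩
  ⨁ (λ v → ⨁ (λ e → A v ∧ (S e ∧ cross (_== v) (ends G e))))     ≡⟨ ⨁-comm _ ⟩
  ⨁ (λ e → ⨁ (λ v → A v ∧ (S e ∧ cross (_== v) (ends G e))))     ≡⟨ ⨁-cong (λ e → ⨁-cross A (S e) (ends G e)) ⟩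
  ⨁ (λ e → S e ∧ cross A (ends G e))                             ∎
  where open ≡-Reasoning

handshake : ∀ G → Regular 4 G → ∀ A → ⨁ (λ e → cross A (ends G e)) ≡ false
handshake G reg A =
  trans (sym (⨁-∧-odd-wdeg G A (λ _ → true)))
        (⨁-false λ v → trans (cong (λ d → A v ∧ odd d) (reg v)) (∧-zeroʳ (A v)))

-- This is `fredholm` for the incidence matrix with all rows outside `S` set to zero. A vector
-- orthogonal to the row of an edge is a vertex set which that edge does not leave.
join-or-cut : ∀ G (S : Fin (m G) → Bool) (T : Fin (n G) → Bool) →
  (Σ (Fin (m G) → Bool) λ F → (∀ e → F e ≡ true → S e ≡ true) × (∀ v → odd (wdeg G F v) ≡ T v)) ⊎
  (Σ (Fin (n G) → Bool) λ A → (∀ e → S e ≡ true → cross A (ends G e) ≡ false) × ⨁ (λ v → A v ∧ T v) ≡ true)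
join-or-cut G S T with fredholm (λ e v → S e ∧ cross (_== v) (ends G e)) T
... | inj₁ (F , ∂F≡T) = inj₁ ((λ e → F e ∧ S e) , within , boundary)
  where
  within : ∀ e → F e ∧ S e ≡ true → S e ≡ true
  within e with true ← F e = λ Se → Se
  boundary : ∀ v → odd (wdeg G (λ e → F e ∧ S e) v) ≡ T v
  boundary v = trans (odd-wdeg G _ v) (trans (⨁-cong λ e → ∧-assoc (F e) (S e) _) (∂F≡T v))
... | inj₂ (A , A⊥ , A·T) = inj₂ (A , closed , A·T)
  where
  closed : ∀ e → S e ≡ true → cross A (ends G e) ≡ false
  closed e Se = trans (cong (_∧ cross A (ends G e)) (sym Se)) (trans (sym (⨁-cross A (S e) (ends G e))) (A⊥ e))

-- Colourings

Balanced : (G : Graph) → (Fin (m G) → ℕ) → Fin (n G) → Set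
Balanced G c v = ∃₂ λ x y → x ≢ y × degC G c x v ≡ 3 × degC G c y v ≡ 1

colour-used : ∀ G c x v {k} → degC G c x v ≡ suc k → ∃ λ e → c e ≡ x
colour-used G c x v eq with any? (λ e → c e Nat.≟ x)
... | yes used = used
... | no unused = contradiction (trans (sym eq) (trans (wdeg-cong G v λ e _ → never e) (sumFin-0 (m G)))) λ ()
  where
  never : ∀ e → (c e ≡ᵇ x) ≡ false
  never e = ¬-not λ eq → unused (e , ≡ᵇ⇒≡ (c e) x (subst T (sym eq) _))

-- One balanced vertex already shows two colours in use, which is what the vertex argument is for.
colourable : ∀ G c → Fin (n G) → (∀ v → Balanced G c v) → Colorable 3 1 G
colourable G c v balanced with x , y , x≢y , dx , dy ← balanced v
  with e , ce ← colour-used G c x v dx | e′ , ce′ ← colour-used G c y v dy =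
  c , (e , e′ , λ eq → x≢y (trans (sym ce) (trans eq ce′))) , balanced

odd-splits-4 : ∀ a b → a + b ≡ 4 → odd a ≡ true → (a ≡ 3 × b ≡ 1) ⊎ (a ≡ 1 × b ≡ 3)
odd-splits-4 1 b eq _ = inj₂ (refl , suc-injective eq)
odd-splits-4 3 b eq _ = inj₁ (refl , suc-injective (suc-injective (suc-injective eq)))
odd-splits-4 4 b eq ()
odd-splits-4 (suc (suc (suc (suc (suc a))))) b () _

-- Four is a sum of two odd numbers only as 3 + 1 or 1 + 3. Which of `x` and `y` is the majority
-- colour may vary with the vertex.
balanced-odd : ∀ G → Regular 4 G → ∀ c J x y v → x ≢ y → odd (wdeg G J v) ≡ true →
               (∀ e → incid v (ends G e) ≢ 0 → (c e ≡ᵇ x) ≡ J e) →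
               (∀ e → incid v (ends G e) ≢ 0 → (c e ≡ᵇ y) ≡ not (J e)) → Balanced G c v
balanced-odd G reg c J x y v x≢y oddJ x≗J y≗J
  with odd-splits-4 _ _ (trans (sym (wdeg-complement G J v)) (reg v)) oddJ
... | inj₁ (dJ , dJ′) = x , y , x≢y , trans (wdeg-cong G v x≗J) dJ , trans (wdeg-cong G v y≗J) dJ′
... | inj₂ (dJ , dJ′) = y , x , x≢y ∘ sym , trans (wdeg-cong G v y≗J) dJ′ , trans (wdeg-cong G v x≗J) dJ

-- Only a closed set of odd order could block a subgraph with all degrees odd, but the closed sets
-- of a linked graph are the empty and the full one, both of even order here.
even-colourable : ∀ G → Linked G → Regular 4 G → odd (n G) ≡ false → Fin (n G) → Colorable 3 1 G
even-colourable G linked reg even u with join-or-cut G (λ _ → true) (λ _ → true)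
... | inj₁ (J , _ , oddJ) = colourable G (bit ∘ J) u λ v →
        balanced-odd G reg (bit ∘ J) J 1 0 v (λ ()) (oddJ v) (λ e _ → is1 (J e)) (λ e _ → is0 (J e))
  where
  is1 : ∀ b → (bit b ≡ᵇ 1) ≡ b
  is1 true  = refl
  is1 false = refl
  is0 : ∀ b → (bit b ≡ᵇ 0) ≡ not b
  is0 true  = refl
  is0 false = refl
... | inj₂ (A , closed , odd-A) = contradiction odd-A (λ eq → true≢false eq even-A)
  where
  constant : ∀ v → A v ∧ true ≡ A u ∧ true
  constant v = cong (_∧ true) (linked A (λ e → closed e refl) v u)
  even-A : ⨁ (λ v → A v ∧ true) ≡ false
  even-A = trans (⨁-cong constant) (trans (sym (∧-⨁ (A u) _)) (trans (cong (A u ∧_) (trans (⨁-true (n G)) even)) (∧-zeroʳ (A u))))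

-- Single edges

-- `A` is a union of components of `G - apex`. In a graph of odd order, the remaining vertices other
-- than the apex are then odd in number as well.
record OddCut (G : Graph) : Set where
  field
    apex   : Fin (n G)
    A      : Fin (n G) → Bool
    apex∉A : A apex ≡ false
    closed : ∀ e → cross A (ends G e) ≡ true → touches apex (ends G e) ≡ true
    odd-A  : ⨁ A ≡ true

Joins : (G : Graph) → Fin (n G) → Fin (n G) → Fin (m G) → Set
Joins G u v e = SameEnds (ends G e) (u , v)

OnlyEdge : (G : Graph) → Fin (n G) → Fin (n G) → Fin (m G) → Set
OnlyEdge G u v f = Joins G u v f × (∀ e → Joins G u v e → e ≡ f)

-- `A` is a union of components of `G - u - v`. The formula `parity` is the sum over `A` of the
-- demanded degrees, one plus the number of edges to `u`, with the latter numbers collected into the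
-- edges from `u` to `A`.
record Obstruction (G : Graph) (u v : Fin (n G)) (A : Fin (n G) → Bool) : Set where
  field
    u∉A    : A u ≡ false
    v∉A    : A v ≡ false
    closed : ∀ e → cross A (ends G e) ≡ true → touches u (ends G e) ≡ true ⊎ touches v (ends G e) ≡ true
    parity : ⨁ A xor ⨁ (λ e → touches u (ends G e) ∧ cross A (ends G e)) ≡ true

wdeg≡3 : ∀ G S v f → deg G v ≡ 4 → incid v (ends G f) ≡ 1 → S f ≡ false →
         (∀ e → e ≢ f → incid v (ends G e) ≢ 0 → S e ≡ true) → wdeg G S v ≡ 3
wdeg≡3 G S v f deg≡4 inc Sf S≡true = suc-injective (begin
  1 + wdeg G S v                       ≡⟨ cong (_+ wdeg G S v) inc ⟨
  incid v (ends G f) + wdeg G S v      ≡⟨ cong (_+ wdeg G S v) (sumFin-single (m G) f _) ⟨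
  wdeg G (_== f) v + wdeg G S v        ≡⟨ cong (wdeg G (_== f) v +_) (wdeg-cong G v others) ⟩
  wdeg G (_== f) v + wdeg G (λ e → not (e == f)) v ≡⟨ wdeg-complement G (_== f) v ⟨
  deg G v                              ≡⟨ deg≡4 ⟩
  4                                    ∎)
  where
  open ≡-Reasoning
  others : ∀ e → incid v (ends G e) ≢ 0 → S e ≡ not (e == f)
  others e inc≢0 with e ≟ f
  ... | yes refl = Sf
  ... | no e≢f = S≡true e e≢f inc≢0

incid-joins : ∀ {k} {u v : Fin k} p → u ≢ v → SameEnds p (u , v) → incid u p ≡ 1 × incid v p ≡ 1
incid-joins {u = u} {v} _ u≢v (inj₁ refl)
  rewrite ==-refl u | ==-refl v | ==-≢ u≢v | ==-≢ (u≢v ∘ sym) = refl , refl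
incid-joins {u = u} {v} _ u≢v (inj₂ refl)
  rewrite ==-refl u | ==-refl v | ==-≢ u≢v | ==-≢ (u≢v ∘ sym) = refl , refl

incid-joins-away : ∀ {k} {u v y : Fin k} {p} → y ≢ u → y ≢ v → SameEnds p (u , v) → incid y p ≡ 0
incid-joins-away y≢u y≢v (inj₁ refl) rewrite ==-≢ (y≢u ∘ sym) | ==-≢ (y≢v ∘ sym) = refl
incid-joins-away y≢u y≢v (inj₂ refl) rewrite ==-≢ (y≢u ∘ sym) | ==-≢ (y≢v ∘ sym) = refl

incid⇒touches : ∀ {k} (v : Fin k) p → incid v p ≢ 0 → touches v p ≡ true
incid⇒touches v (a , b) inc with a ≟ v | b ≟ v
... | yes _ | _     = refl
... | no _  | yes _ = refl
... | no _  | no _  = contradiction refl inc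

touches-both : ∀ {k} {u v : Fin k} p → u ≢ v → touches u p ≡ true → touches v p ≡ true → SameEnds p (u , v)
touches-both {u = u} {v} (a , b) u≢v tu tv with a ≟ u | b ≟ u | a ≟ v | b ≟ v
... | yes refl | _ | yes refl | _ = contradiction refl u≢v
... | yes refl | _ | no _ | yes refl = inj₁ refl
... | no _ | yes refl | yes refl | _ = inj₂ refl
... | no _ | yes refl | no _ | yes refl = contradiction refl u≢v

-- All edges at u get colour 1 except f, all edges at v get colour 0 except f, and
-- f alone gets colour 2; a join avoiding u and v balances the other vertices.
single-edge : ∀ G → Regular 4 G → ∀ {u v f} → u ≢ v → OnlyEdge G u v f →
              Colorable 3 1 G ⊎ Σ (Fin (n G) → Bool) (Obstruction G u v)
single-edge G reg {u} {v} {f} u≢v (f-joins , f-only)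
  -- At any other vertex the edges to `u` already have colour 1, so the join must supply the
  -- complementary parity. At `u` and `v` the target is even, since no admissible edge meets them.
  with join-or-cut G (λ e → not (touches u (ends G e)) ∧ not (touches v (ends G e)))
                     (λ y → (not (y == u) ∧ not (y == v)) ∧ not (odd (wdeg G (λ e → touches u (ends G e)) y)))
... | inj₁ (F , F-avoids , oddF) = inj₁ (colourable G c u balanced)
  where
  D J : Fin (m G) → Bool
  D e = touches u (ends G e)
  J e = D e ∨ F e
  c : Fin (m G) → ℕ
  c e = if e == f then 2 else bit (J e)

  F-avoids-u : ∀ e → F e ≡ true → D e ≡ false
  F-avoids-u e Fe with D e | F-avoids e Fe
  ... | false | _ = refl

  J-disjoint : ∀ e → bit (J e) ≡ bit (D e) + bit (F e)
  J-disjoint e with D e | F e | F-avoids-u e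
  ... | true  | true  | avoid = contradiction (avoid refl) λ ()
  ... | true  | false | _ = refl
  ... | false | _     | _ = refl

  c≡2 : ∀ e → (c e ≡ᵇ 2) ≡ (e == f)
  c≡2 e with e == f | J e
  ... | true  | _     = refl
  ... | false | true  = refl
  ... | false | false = refl

  c≡1 : ∀ e → e ≢ f → (c e ≡ᵇ 1) ≡ J e
  c≡1 e e≢f rewrite ==-≢ e≢f with J e
  ... | true  = refl
  ... | false = refl

  c≡0 : ∀ e → e ≢ f → (c e ≡ᵇ 0) ≡ not (J e)
  c≡0 e e≢f rewrite ==-≢ e≢f with J e
  ... | true  = refl
  ... | false = refl

  cf≢ : ∀ k → k < 2 → (c f ≡ᵇ k) ≡ false
  cf≢ k k<2 rewrite ==-refl f with k | k<2
  ... | 0 | _ = refl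
  ... | 1 | _ = refl
  ... | suc (suc _) | s≤s (s≤s ())

  degC-2 : ∀ y → incid y (ends G f) ≡ 1 → degC G c 2 y ≡ 1
  degC-2 y inc = trans (wdeg-cong G y λ e _ → c≡2 e) (trans (sumFin-single (m G) f _) inc)

  away : ∀ y → y ≢ u → y ≢ v → ∀ e → incid y (ends G e) ≢ 0 → e ≢ f
  away y y≢u y≢v e inc refl = inc (incid-joins-away y≢u y≢v f-joins)

  balanced : ∀ y → Balanced G c y
  balanced y with y ≟ u | y ≟ v
  ... | yes refl | _ = 1 , 2 , (λ ()) ,
          wdeg≡3 G _ u f (reg u) (proj₁ (incid-joins (ends G f) u≢v f-joins)) (cf≢ 1 (s≤s (s≤s z≤n)))
            (λ e e≢f inc → trans (c≡1 e e≢f) (cong (_∨ F e) (incid⇒touches u (ends G e) inc))) ,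
          degC-2 u (proj₁ (incid-joins (ends G f) u≢v f-joins))
  ... | no _ | yes refl = 0 , 2 , (λ ()) ,
          wdeg≡3 G _ v f (reg v) (proj₂ (incid-joins (ends G f) u≢v f-joins)) (cf≢ 0 (s≤s z≤n))
            (λ e e≢f inc → trans (c≡0 e e≢f) (cong not (outside e e≢f (incid⇒touches v (ends G e) inc)))) ,
          degC-2 v (proj₂ (incid-joins (ends G f) u≢v f-joins))
    where
    outside : ∀ e → e ≢ f → touches v (ends G e) ≡ true → J e ≡ false
    outside e e≢f tv with touches u (ends G e) in tu | F e in Fe
    ... | true  | _     = contradiction (f-only e (touches-both (ends G e) u≢v tu tv)) e≢f
    ... | false | false = refl
    ... | false | true  = contradiction (F-avoids e Fe) λ eq →
            contradiction (trans (sym eq) (cong₂ (λ a b → not a ∧ not b) tu tv)) λ ()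
  ... | no y≢u | no y≢v = balanced-odd G reg c J 1 0 y (λ ()) odd-J
          (λ e inc → c≡1 e (away y y≢u y≢v e inc)) (λ e inc → c≡0 e (away y y≢u y≢v e inc))
    where
    xor-not : ∀ b → b xor not b ≡ true
    xor-not true  = refl
    xor-not false = refl
    odd-F : odd (wdeg G F y) ≡ not (odd (wdeg G D y))
    odd-F = trans (oddF y) (cong₂ (λ a b → (not a ∧ not b) ∧ not (odd (wdeg G D y))) (==-≢ y≢u) (==-≢ y≢v))
    odd-J : odd (wdeg G J y) ≡ true
    odd-J = trans (cong odd (wdeg-disjoint G J-disjoint y))
             (trans (odd-+ (wdeg G D y) _) (trans (cong (odd (wdeg G D y) xor_) odd-F) (xor-not (odd (wdeg G D y)))))
... | inj₂ (A , A-closed , A·T) = inj₂ (A₀ , record { u∉A = A₀u ; v∉A = A₀v ; closed = closed ; parity = parity })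
  where
  D : Fin (m G) → Bool
  D e = touches u (ends G e)
  -- The certificate may contain `u` or `v`. The target vanishes at both, so removing them keeps its
  -- sum over the set.
  A₀ : Fin (n G) → Bool
  A₀ y = A y ∧ (not (y == u) ∧ not (y == v))
  A₀u : A₀ u ≡ false
  A₀u rewrite ==-refl u = ∧-zeroʳ (A u)
  A₀v : A₀ v ≡ false
  A₀v rewrite ==-refl v | ∧-zeroʳ (not (v == u)) = ∧-zeroʳ (A v)
  A₀-away : ∀ p → touches u p ≡ false → touches v p ≡ false → cross A₀ p ≡ cross A p
  A₀-away (a , b) tu tv with a == u | b == u | a == v | b == v
  ... | false | false | false | false = cong₂ _xor_ (∧-identityʳ (A a)) (∧-identityʳ (A b))
  closed : ∀ e → cross A₀ (ends G e) ≡ true → touches u (ends G e) ≡ true ⊎ touches v (ends G e) ≡ true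
  closed e crosses with touches u (ends G e) in tu | touches v (ends G e) in tv
  ... | true  | _    = inj₁ refl
  ... | false | true = inj₂ refl
  ... | false | false = contradiction (A-closed e (cong₂ (λ a b → not a ∧ not b) tu tv))
                          (true≢false (trans (sym (A₀-away (ends G e) tu tv)) crosses))
  regroup : ∀ a t d → a ∧ (t ∧ not d) ≡ (a ∧ t) xor ((a ∧ t) ∧ d)
  regroup true  true  d = refl
  regroup true  false d = refl
  regroup false t     d = refl
  parity : ⨁ A₀ xor ⨁ (λ e → D e ∧ cross A₀ (ends G e)) ≡ true
  parity = begin
    ⨁ A₀ xor ⨁ (λ e → D e ∧ cross A₀ (ends G e))       ≡⟨ cong (⨁ A₀ xor_) (⨁-∧-odd-wdeg G A₀ D) ⟨
    ⨁ A₀ xor ⨁ (λ y → A₀ y ∧ odd (wdeg G D y))         ≡⟨ ⨁-xor A₀ _ ⟨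
    ⨁ (λ y → A₀ y xor (A₀ y ∧ odd (wdeg G D y)))       ≡⟨ ⨁-cong (λ y → regroup (A y) _ _) ⟨
    ⨁ (λ y → A y ∧ ((not (y == u) ∧ not (y == v)) ∧ not (odd (wdeg G D y)))) ≡⟨ A·T ⟩
    true                                               ∎
    where open ≡-Reasoning

crossing : ∀ {k} (A : Fin k → Bool) p → cross A p ≡ true →
           ∃₂ λ x y → SameEnds p (x , y) × A x ≡ true × A y ≡ false
crossing A (a , b) crosses with A a in Aa | A b in Ab
... | true  | false = a , b , inj₁ refl , Aa , Ab
... | false | true  = b , a , inj₂ refl , Ab , Aa

cross-joins : ∀ {k} (A : Fin k → Bool) {x y} p → SameEnds p (x , y) → cross A p ≡ A x xor A y
cross-joins A _ (inj₁ refl) = refl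
cross-joins A {x} {y} _ (inj₂ refl) = xor-comm (A y) (A x)

touches-joinsˡ : ∀ {k} {x y : Fin k} p → SameEnds p (x , y) → touches x p ≡ true
touches-joinsˡ {x = x} _ (inj₁ refl) rewrite ==-refl x = refl
touches-joinsˡ {x = x} {y} _ (inj₂ refl) rewrite ==-refl x = ∨-zeroʳ (y == x)

joins-sym : ∀ {k} {x y : Fin k} {p} → SameEnds p (x , y) → SameEnds p (y , x)
joins-sym (inj₁ refl) = inj₂ refl
joins-sym (inj₂ refl) = inj₁ refl

touches-joinsʳ : ∀ {k} {x y : Fin k} p → SameEnds p (x , y) → touches y p ≡ true
touches-joinsʳ p joins = touches-joinsˡ p (joins-sym joins)

touched : ∀ {k} {v x y : Fin k} p → SameEnds p (x , y) → touches v p ≡ true → x ≡ v ⊎ y ≡ v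
touched {v = v} {x} {y} _ (inj₁ refl) t with x ≟ v | y ≟ v
... | yes x≡v | _ = inj₁ x≡v
... | no _ | yes y≡v = inj₂ y≡v
touched {v = v} {x} {y} _ (inj₂ refl) t with x ≟ v | y ≟ v
... | yes x≡v | _ = inj₁ x≡v
... | no _ | yes y≡v = inj₂ y≡v

separated : ∀ {k} (A : Fin k → Bool) {x y} → A x ≡ true → A y ≡ false → x ≢ y
separated A Ax Ay refl = true≢false Ax Ay

avoids : ∀ {k} {v : Fin k} p → touches v p ≡ false → proj₁ p ≢ v × proj₂ p ≢ v
avoids {v = v} (a , b) t = (λ { refl → true≢false (touches-joinsˡ (a , b) (inj₁ refl)) t }) ,
                           (λ { refl → true≢false (touches-joinsʳ (a , b) (inj₁ refl)) t })

cross-xor : ∀ {k} {A B C : Fin k → Bool} → (∀ x → A x ≡ B x xor C x) → ∀ p → cross A p ≡ cross B p xor cross C p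
cross-xor {B = B} {C} eq (a , b) rewrite eq a | eq b = xor-interchange (B a) (C a) (B b) (C b)

-- Obstructions at the two ends of a single edge

module TwoVertexCuts (G : Graph) (reg : Regular 4 G) where

  boundary : Fin (n G) → (Fin (n G) → Bool) → Fin (m G) → Bool
  boundary u A e = touches u (ends G e) ∧ cross A (ends G e)

  rest : Fin (n G) → Fin (n G) → (Fin (n G) → Bool) → Fin (n G) → Bool
  rest u v A y = not (A y) ∧ (not (y == u) ∧ not (y == v))

  touches-both≡only : ∀ {u v f} → u ≢ v → OnlyEdge G u v f → ∀ e →
                      touches u (ends G e) ∧ touches v (ends G e) ≡ (e == f)
  touches-both≡only {u} {v} {f} u≢v (joins , only) e with e ≟ f
  ... | yes refl rewrite touches-joinsˡ (ends G e) joins | touches-joinsʳ (ends G e) joins = refl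
  ... | no e≢f with touches u (ends G e) in tu | touches v (ends G e) in tv
  ...   | false | _     = refl
  ...   | true  | false = refl
  ...   | true  | true  = contradiction (only e (touches-both (ends G e) u≢v tu tv)) e≢f

  -- Passing to the complement flips both terms of `parity`: the order because `n G - 2` is odd, and
  -- the number of edges at `u` because, of its four ends, one belongs to `f` and loops take an even
  -- number.
  rest-obstruction : ∀ {u v f A} → odd (n G) ≡ true → u ≢ v → OnlyEdge G u v f →
                     Obstruction G u v A → Obstruction G u v (rest u v A)
  rest-obstruction {u} {v} {f} {A} odd-n u≢v only obs = record
    { u∉A = restu ; v∉A = restv ; closed = closed′ ; parity = parity′ }
    where
    open Obstruction obs
    B U : Fin (n G) → Bool
    B = rest u v A
    U y = (y == u) xor (y == v)
    restu : B u ≡ false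
    restu rewrite ==-refl u = ∧-zeroʳ (not (A u))
    restv : B v ≡ false
    restv rewrite ==-refl v | ∧-zeroʳ (not (v == u)) = ∧-zeroʳ (not (A v))
    B≡ : ∀ y → B y ≡ A y xor not (U y)
    B≡ y with y ≟ u | y ≟ v
    ... | yes refl | yes refl = contradiction refl u≢v
    ... | yes refl | no _ rewrite u∉A = refl
    ... | no _ | yes refl rewrite v∉A = refl
    ... | no _ | no _ with A y
    ...   | true  = refl
    ...   | false = refl
    cross-not : ∀ p → cross (not ∘ U) p ≡ cross U p
    cross-not (a , b) = xor-annihilates-not (U a) (U b)
    cross-B : ∀ p → cross B p ≡ cross A p xor cross U p
    cross-B p = trans (cross-xor {B = A} {C = not ∘ U} B≡ p) (cong (cross A p xor_) (cross-not p))
    cross-U : ∀ p → touches u p ≡ false → touches v p ≡ false → cross U p ≡ false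
    cross-U (a , b) tu tv with a == u | b == u | a == v | b == v
    ... | false | false | false | false = refl
    closed′ : ∀ e → cross B (ends G e) ≡ true → touches u (ends G e) ≡ true ⊎ touches v (ends G e) ≡ true
    closed′ e crosses with touches u (ends G e) in tu | touches v (ends G e) in tv
    ... | true  | _    = inj₁ refl
    ... | false | true = inj₂ refl
    ... | false | false with closed e (trans (sym (trans (cross-B (ends G e))
            (trans (cong (cross A (ends G e) xor_) (cross-U (ends G e) tu tv)) (xor-identityʳ _)))) crosses)
    ...   | inj₁ tu′ = contradiction tu (true≢false tu′)
    ...   | inj₂ tv′ = contradiction tv (true≢false tv′)
    touch-U : ∀ p → touches u p ∧ cross U p ≡ cross (_== u) p xor (touches u p ∧ touches v p)
    touch-U (a , b) with a ≟ u | a ≟ v | b ≟ u | b ≟ v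
    ... | yes refl | yes refl | _ | _ = contradiction refl u≢v
    ... | _ | _ | yes refl | yes refl = contradiction refl u≢v
    ... | yes _ | no _ | yes _ | no _ = refl
    ... | yes _ | no _ | no _ | yes _ = refl
    ... | yes _ | no _ | no _ | no _ = refl
    ... | no _ | yes _ | yes _ | no _ = refl
    ... | no _ | yes _ | no _ | yes _ = refl
    ... | no _ | yes _ | no _ | no _ = refl
    ... | no _ | no _ | yes _ | no _ = refl
    ... | no _ | no _ | no _ | yes _ = refl
    ... | no _ | no _ | no _ | no _ = refl
    boundary-B : ⨁ (boundary u B) ≡ not (⨁ (boundary u A))
    boundary-B = begin
      ⨁ (boundary u B)
        ≡⟨ ⨁-cong (λ e → trans (cong (touches u (ends G e) ∧_) (cross-B (ends G e)))
             (trans (∧-distribˡ-xor (touches u (ends G e)) _ _)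
               (cong (boundary u A e xor_) (trans (touch-U (ends G e))
                 (cong (cross (_== u) (ends G e) xor_) (touches-both≡only u≢v only e)))))) ⟩
      ⨁ (λ e → boundary u A e xor (cross (_== u) (ends G e) xor (e == f)))
        ≡⟨ ⨁-xor _ _ ⟩
      ⨁ (boundary u A) xor ⨁ (λ e → cross (_== u) (ends G e) xor (e == f))
        ≡⟨ cong (⨁ (boundary u A) xor_) (⨁-xor _ _) ⟩
      ⨁ (boundary u A) xor (⨁ (λ e → cross (_== u) (ends G e)) xor ⨁ (_== f))
        ≡⟨ cong (⨁ (boundary u A) xor_) (cong₂ _xor_ (handshake G reg (_== u)) (⨁-== f)) ⟩
      ⨁ (boundary u A) xor true
        ≡⟨ xor-comm _ true ⟩
      not (⨁ (boundary u A))
        ∎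
      where open ≡-Reasoning
    size-B : ⨁ B ≡ not (⨁ A)
    size-B = begin
      ⨁ B                                               ≡⟨ ⨁-cong B≡ ⟩
      ⨁ (λ y → A y xor (true xor U y))                  ≡⟨ ⨁-xor A _ ⟩
      ⨁ A xor ⨁ (λ y → true xor U y)                    ≡⟨ cong (⨁ A xor_) (⨁-xor (λ _ → true) U) ⟩
      ⨁ A xor (⨁ {n G} (λ _ → true) xor ⨁ U)            ≡⟨ cong (⨁ A xor_) (cong₂ _xor_ (trans (⨁-true (n G)) odd-n)
                                                            (trans (⨁-xor (_== u) (_== v)) (cong₂ _xor_ (⨁-== u) (⨁-== v)))) ⟩
      ⨁ A xor true                                      ≡⟨ xor-comm _ true ⟩
      not (⨁ A)                                         ∎
      where open ≡-Reasoning
    parity′ : ⨁ B xor ⨁ (boundary u B) ≡ true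
    parity′ rewrite boundary-B | size-B = trans (xor-annihilates-not (⨁ A) _) parity

  -- Each end at `u` serves at most one purpose: its edge leads into `A`, into `B`, or to `v`.
  boundary-≤ : ∀ {k} {u v : Fin k} (A B : Fin k → Bool) → u ≢ v →
               A u ≡ false → A v ≡ false → B u ≡ false → B v ≡ false → (∀ y → A y ∧ B y ≡ false) → ∀ p →
               bit (touches u p ∧ cross A p) + bit (touches u p ∧ cross B p) + bit (touches u p ∧ touches v p) ≤ incid u p
  boundary-≤ {u = u} {v} A B u≢v Au Av Bu Bv disj (a , b) with a ≟ u | b ≟ u | a ≟ v | b ≟ v
  ... | yes refl | _ | yes refl | _ = contradiction refl u≢v
  ... | _ | yes refl | _ | yes refl = contradiction refl u≢v
  ... | no _ | no _ | _ | _ = z≤n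
  ... | yes refl | yes refl | no _ | no _ rewrite Au | Bu = z≤n
  ... | yes refl | no _ | no _ | yes refl rewrite Au | Bu | Av | Bv = ≤-refl
  ... | no _ | yes refl | yes refl | no _ rewrite Au | Bu | Av | Bv = ≤-refl
  ... | yes refl | no _ | no _ | no _ rewrite Au | Bu with A b | B b | disj b
  ...   | true  | false | _ = ≤-refl
  ...   | false | true  | _ = ≤-refl
  ...   | false | false | _ = z≤n
  boundary-≤ {u = u} {v} A B u≢v Au Av Bu Bv disj (a , b) | no _ | yes refl | no _ | no _ rewrite Au | Bu with A a | B a | disj a
  ...   | true  | false | _ = ≤-refl
  ...   | false | true  | _ = ≤-refl
  ...   | false | false | _ = z≤n

  -- The bound is four minus the end taken by `f`.
  count-boundary-≤ : ∀ {u v f A B} → u ≢ v → OnlyEdge G u v f → Obstruction G u v A → Obstruction G u v B →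
                     (∀ y → A y ∧ B y ≡ false) →
                     count (boundary u A) + count (boundary u B) ≤ 3 × count (boundary v A) + count (boundary v B) ≤ 3
  count-boundary-≤ {u} {v} {f} {A} {B} u≢v only obsA obsB disj =
    bound (λ e → touches-both≡only u≢v only e)
          (boundary-≤ A B u≢v (u∉A obsA) (v∉A obsA) (u∉A obsB) (v∉A obsB) disj) ,
    bound (λ e → trans (∧-comm (touches v (ends G e)) _) (touches-both≡only u≢v only e))
          (boundary-≤ A B (u≢v ∘ sym) (v∉A obsA) (u∉A obsA) (v∉A obsB) (u∉A obsB) disj)
    where
    open Obstruction
    bound : ∀ {x y} → (∀ e → touches x (ends G e) ∧ touches y (ends G e) ≡ (e == f)) →
            (∀ p → bit (touches x p ∧ cross A p) + bit (touches x p ∧ cross B p) + bit (touches x p ∧ touches y p) ≤ incid x p) →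
            count (boundary x A) + count (boundary x B) ≤ 3
    bound {x} {y} isf pointwise = s≤s⁻¹ (begin
      1 + (count (boundary x A) + count (boundary x B))
        ≡⟨ +-comm 1 _ ⟩
      count (boundary x A) + count (boundary x B) + 1
        ≡⟨ cong₂ _+_ (sumFin-+ (m G) _ _) (trans (sumFin-cong (m G) λ e → cong bit (isf e)) (sumFin-single (m G) f (λ _ → 1))) ⟨
      sumFin (m G) (λ e → bit (boundary x A e) + bit (boundary x B e)) + count (λ e → touches x (ends G e) ∧ touches y (ends G e))
        ≡⟨ sumFin-+ (m G) _ _ ⟨
      sumFin (m G) (λ e → bit (boundary x A e) + bit (boundary x B e) + bit (touches x (ends G e) ∧ touches y (ends G e)))
        ≤⟨ sumFin-mono (m G) (λ e → pointwise (ends G e)) ⟩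
      deg G x
        ≡⟨ reg x ⟩
      4 ∎)
      where open ≤-Reasoning

  -- No edge leaving `A` touches both `u` and `v`, so the two counts add up to a cut, which is even
  -- and hence at most two. If one count is zero, the other is even and `parity` makes `A` odd,
  -- attached at a single vertex. Otherwise both are one and `A` is even.
  classify : ∀ {u v A} → u ≢ v → Obstruction G u v A → count (boundary u A) + count (boundary v A) ≤ 3 →
             OddCut G ⊎ (count (boundary u A) ≡ 1 × count (boundary v A) ≡ 1 × ⨁ A ≡ false)
  classify {u} {v} {A} u≢v obs bound
    with count (boundary u A) in cu | count (boundary v A) in cv
  ... | au | av = go au av cu cv bound same-parity
    where
    open Obstruction obs
    split : ∀ e → cross A (ends G e) ≡ boundary u A e xor boundary v A e
    split e with cross A (ends G e) in crosses
    ... | false = sym (cong₂ _xor_ (∧-zeroʳ (touches u (ends G e))) (∧-zeroʳ (touches v (ends G e))))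
    ... | true with touches u (ends G e) in tu | touches v (ends G e) in tv | closed e crosses
    ...   | true  | false | _ = refl
    ...   | false | true  | _ = refl
    ...   | false | false | inj₁ ()
    ...   | false | false | inj₂ ()
    ...   | true  | true  | _ = contradiction (trans (cross-joins A _ (touches-both (ends G e) u≢v tu tv)) (cong₂ _xor_ u∉A v∉A)) (true≢false crosses)
    same-parity : odd (count (boundary u A)) xor odd (count (boundary v A)) ≡ false
    same-parity = begin
      odd (count (boundary u A)) xor odd (count (boundary v A)) ≡⟨ cong₂ _xor_ (odd-count (boundary u A)) (odd-count (boundary v A)) ⟩
      ⨁ (boundary u A) xor ⨁ (boundary v A)                     ≡⟨ ⨁-xor _ _ ⟨
      ⨁ (λ e → boundary u A e xor boundary v A e)               ≡⟨ ⨁-cong split ⟨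
      ⨁ (λ e → cross A (ends G e))                              ≡⟨ handshake G reg A ⟩
      false                                                     ∎
      where open ≡-Reasoning
    odd-A : ∀ {b} → odd (count (boundary u A)) ≡ b → ⨁ A ≡ not b
    odd-A eq = xor-solve parity (trans (sym (odd-count (boundary u A))) eq)
    none : ∀ {x e} → count (boundary x A) ≡ 0 → cross A (ends G e) ≡ true → touches x (ends G e) ≢ true
    none {x} {e} eq crosses t = true≢false (cong₂ _∧_ t crosses) (count≡0 (boundary x A) eq e)
    go : ∀ au av → count (boundary u A) ≡ au → count (boundary v A) ≡ av → au + av ≤ 3 →
         odd (count (boundary u A)) xor odd (count (boundary v A)) ≡ false → OddCut G ⊎ (au ≡ 1 × av ≡ 1 × ⨁ A ≡ false)
    go zero av eu ev _ _ = inj₁ record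
      { apex = v ; A = A ; apex∉A = v∉A ; odd-A = odd-A (cong odd eu)
      ; closed = λ e crosses → fromInj₂ (λ t → contradiction t (none eu crosses)) (closed e crosses) }
    go au zero eu ev _ par = inj₁ record
      { apex = u ; A = A ; apex∉A = u∉A
      ; odd-A = odd-A (trans (sym (xor-identityʳ _)) (trans (cong (λ k → odd (count (boundary u A)) xor odd k) (sym ev)) par))
      ; closed = λ e crosses → fromInj₁ (λ t → contradiction t (none ev crosses)) (closed e crosses) }
    go 1 1 eu ev _ _ = inj₂ (refl , refl , odd-A (cong odd eu))
    go 1 2 eu ev _ par rewrite eu | ev = contradiction par λ ()
    go 2 1 eu ev _ par rewrite eu | ev = contradiction par λ ()
    go 1 (suc (suc (suc _))) _ _ (s≤s (s≤s (s≤s ()))) _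
    go 2 (suc (suc _)) _ _ (s≤s (s≤s (s≤s ()))) _
    go (suc (suc (suc au))) (suc av) _ _ (s≤s (s≤s (s≤s le))) _ with () ← ≤-trans (≤-reflexive (sym (+-suc au av))) le

-- Even sets left by one edge at each of two vertices

joins-unique : ∀ {k} {a b c d : Fin k} {p} → SameEnds p (a , b) → SameEnds p (c , d) →
               (a ≡ c × b ≡ d) ⊎ (a ≡ d × b ≡ c)
joins-unique (inj₁ refl) (inj₁ refl) = inj₁ (refl , refl)
joins-unique (inj₁ refl) (inj₂ refl) = inj₂ (refl , refl)
joins-unique (inj₂ refl) (inj₁ refl) = inj₂ (refl , refl)
joins-unique (inj₂ refl) (inj₂ refl) = inj₁ (refl , refl)

∧-splitsˡ : ∀ a b → a ≡ (a ∧ b) xor (a ∧ not b)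
∧-splitsˡ true  true  = refl
∧-splitsˡ true  false = refl
∧-splitsˡ false _     = refl

∧-true : ∀ {a b} → a ∧ b ≡ true → a ≡ true × b ≡ true
∧-true {true} {true} _ = refl , refl

module EvenTwoCut (G : Graph) (reg : Regular 4 G) (odd-n : odd (n G) ≡ true)
  (X : Fin (n G) → Bool) (even-X : ⨁ X ≡ false)
  {u v s q : Fin (n G)} (u≢v : u ≢ v) (Xu : X u ≡ false) (Xv : X v ≡ false) (Xs : X s ≡ true) (Xq : X q ≡ true)
  {g h : Fin (m G)} (g-joins : Joins G u s g) (h-joins : Joins G v q h)
  (leaving : ∀ e → cross X (ends G e) ≡ true → e ≡ g ⊎ e ≡ h)
  where

  open TwoVertexCuts G reg

  u≢s : u ≢ s
  u≢s = separated X Xs Xu ∘ sym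

  leaving-end : ∀ {x y e} → Joins G x y e → X x ≡ true → X y ≡ false → (x ≡ s × y ≡ u) ⊎ (x ≡ q × y ≡ v)
  leaving-end {x} {y} {e} joins Xx Xy
    with leaving e (trans (cross-joins X (ends G e) joins) (cong₂ _xor_ Xx Xy))
  ... | inj₁ refl with joins-unique joins g-joins
  ...   | inj₁ (refl , _) = contradiction Xu (true≢false Xx)
  ...   | inj₂ (x≡s , y≡u) = inj₁ (x≡s , y≡u)
  leaving-end joins Xx Xy | inj₂ refl with joins-unique joins h-joins
  ...   | inj₁ (refl , _) = contradiction Xv (true≢false Xx)
  ...   | inj₂ (x≡q , y≡v) = inj₂ (x≡q , y≡v)

  -- Both edges leaving `X` start at `s`, and deleting `s` turns the even set into an odd one.
  common-end : s ≡ q → OddCut G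
  common-end s≡q = record
    { apex = s ; A = λ y → X y ∧ not (y == s) ; apex∉A = s∉ ; closed = closed ; odd-A = odd-A }
    where
    s∉ : X s ∧ not (s == s) ≡ false
    s∉ rewrite ==-refl s = ∧-zeroʳ (X s)
    closed : ∀ e → cross (λ y → X y ∧ not (y == s)) (ends G e) ≡ true → touches s (ends G e) ≡ true
    closed e crosses with crossing (λ y → X y ∧ not (y == s)) (ends G e) crosses
    ... | x , y , joins , Ax , Ay with X y in Xy | ∧-true {X x} {not (x == s)} Ax
    ...   | false | Xx , _ with leaving-end joins Xx Xy
    ...     | inj₁ (refl , _) = touches-joinsˡ (ends G e) joins
    ...     | inj₂ (refl , _) rewrite s≡q = touches-joinsˡ (ends G e) joins
    closed e crosses | x , y , joins , Ax , Ay | true | Xx , _ with y ≟ s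
    ...     | yes refl = touches-joinsʳ (ends G e) joins
    closed e crosses | x , y , joins , Ax , () | true | Xx , _ | no _
    odd-A : ⨁ (λ y → X y ∧ not (y == s)) ≡ true
    odd-A = trans (⨁-cong λ y → trans (∧-distribˡ-xor (X y) true (y == s))
                                  (cong₂ _xor_ (∧-identityʳ (X y)) (cong (X y ∧_) (==-sym y s))))
             (trans (⨁-xor X _) (cong₂ _xor_ even-X (trans (⨁-single X s) Xs)))

  -- Permits a second use of `single-edge`, now at an edge of the cut around `X`.
  g-only : OnlyEdge G u s g
  g-only = g-joins , only
    where
    only : ∀ e → Joins G u s e → e ≡ g
    only e joins with leaving e (trans (cross-joins X (ends G e) joins) (cong₂ _xor_ Xu Xs))
    ... | inj₁ e≡g = e≡g
    ... | inj₂ refl with joins-unique joins h-joins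
    ...   | inj₁ (u≡v , _) = contradiction u≡v u≢v
    ...   | inj₂ (refl , _) = contradiction Xu (true≢false Xq)

  -- The part of the obstruction inside X is attached to the rest only at s,
  -- and the part outside X only at u; one of the two is odd.
  split-obstruction : s ≢ q → ∀ {A} → Obstruction G u s A → A q ≡ false → OddCut G
  split-obstruction s≢q {A} obs Aq = decide (⨁ inner) refl
    where
    open Obstruction obs renaming (v∉A to s∉A)
    inner outer : Fin (n G) → Bool
    inner y = A y ∧ X y
    outer y = A y ∧ not (X y)

    -- Otherwise `h` would leave `A`, though neither of its ends is `u` or `s`.
    Av : A v ≡ false
    Av with A v in Av′
    ... | false = refl
    ... | true with closed h (trans (cross-joins A (ends G h) h-joins) (cong₂ _xor_ Av′ Aq))
    ...   | inj₁ tu with touched (ends G h) h-joins tu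
    ...     | inj₁ v≡u = contradiction (sym v≡u) u≢v
    ...     | inj₂ refl = contradiction Xu (true≢false Xq)
    Av | true | inj₂ ts with touched (ends G h) h-joins ts
    ...     | inj₁ refl = contradiction Xv (true≢false Xs)
    ...     | inj₂ q≡s = contradiction (sym q≡s) s≢q

    inner-closed : ∀ {x y e} → Joins G x y e → inner x ≡ true → inner y ≡ false → y ≡ s
    inner-closed {x} {y} {e} joins ix iy with ∧-true {A x} ix | X y in Xy | A y in Ay
    ... | Ax , Xx | false | _ with leaving-end joins Xx Xy
    ...   | inj₁ (refl , _) = contradiction s∉A (true≢false Ax)
    ...   | inj₂ (refl , _) = contradiction Aq (true≢false Ax)
    inner-closed {x} {y} {e} joins ix iy | Ax , Xx | true | false
      with closed e (trans (cross-joins A (ends G e) joins) (cong₂ _xor_ Ax Ay))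
    ... | inj₁ tu with touched (ends G e) joins tu
    ...   | inj₁ refl = contradiction Xu (true≢false Xx)
    ...   | inj₂ refl = contradiction Xu (true≢false Xy)
    inner-closed {x} {y} {e} joins ix iy | Ax , Xx | true | false | inj₂ ts with touched (ends G e) joins ts
    ...   | inj₁ refl = contradiction s∉A (true≢false Ax)
    ...   | inj₂ y≡s = y≡s

    outer-closed : ∀ {x y e} → Joins G x y e → outer x ≡ true → outer y ≡ false → y ≡ u
    outer-closed {x} {y} {e} joins ox oy with X x in Xx | ∧-true {A x} {not (X x)} ox | X y in Xy | A y in Ay
    ... | true | _ , () | _ | _
    ... | false | Ax , _ | true | _ with leaving-end (joins-sym joins) Xy Xx
    ...   | inj₁ (_ , refl) = contradiction u∉A (true≢false Ax)
    ...   | inj₂ (_ , refl) = contradiction Av (true≢false Ax)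
    outer-closed {x} {y} {e} joins ox oy | false | Ax , _ | false | false
      with closed e (trans (cross-joins A (ends G e) joins) (cong₂ _xor_ Ax Ay))
    ... | inj₁ tu with touched (ends G e) joins tu
    ...   | inj₁ refl = contradiction u∉A (true≢false Ax)
    ...   | inj₂ y≡u = y≡u
    outer-closed {x} {y} {e} joins ox oy | false | Ax , _ | false | false | inj₂ ts with touched (ends G e) joins ts
    ...   | inj₁ refl = contradiction s∉A (true≢false Ax)
    ...   | inj₂ refl = contradiction Xy (true≢false Xs)

    inner-touches : ∀ e → cross inner (ends G e) ≡ true → touches s (ends G e) ≡ true
    inner-touches e crosses with x , y , joins , ix , iy ← crossing inner (ends G e) crosses
      with refl ← inner-closed joins ix iy = touches-joinsʳ (ends G e) joins

    outer-touches : ∀ e → cross outer (ends G e) ≡ true → touches u (ends G e) ≡ true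
    outer-touches e crosses with x , y , joins , ox , oy ← crossing outer (ends G e) crosses
      with refl ← outer-closed joins ox oy = touches-joinsʳ (ends G e) joins

    inner-avoids-u : ∀ e → touches u (ends G e) ∧ cross inner (ends G e) ≡ false
    inner-avoids-u e with touches u (ends G e) in tu | cross inner (ends G e) in crosses
    ... | false | _     = refl
    ... | true  | false = refl
    ... | true  | true with x , y , joins , ix , iy ← crossing inner (ends G e) crosses
          with refl ← inner-closed joins ix iy | touched (ends G e) joins tu
    ...   | inj₁ refl = contradiction Xu (true≢false (proj₂ (∧-true {A x} ix)))
    ...   | inj₂ s≡u = contradiction (sym s≡u) u≢s

    boundary≡ : ∀ e → boundary u A e ≡ cross outer (ends G e)
    boundary≡ e rewrite cross-xor {A = A} {inner} {outer} (λ y → ∧-splitsˡ (A y) (X y)) (ends G e)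
      | ∧-distribˡ-xor (touches u (ends G e)) (cross inner (ends G e)) (cross outer (ends G e))
      | inner-avoids-u e
      with touches u (ends G e) | cross outer (ends G e) | outer-touches e
    ... | true  | _     | _ = refl
    ... | false | false | _ = refl
    ... | false | true  | t = contradiction (t refl) λ ()

    -- The edges at `u` that leave `A` are exactly the edges leaving `outer`. As a cut they are even
    -- in number, so `parity` forces `A` itself to be odd.
    odd-inner-outer : ⨁ inner xor ⨁ outer ≡ true
    odd-inner-outer = begin
      ⨁ inner xor ⨁ outer         ≡⟨ ⨁-xor inner outer ⟨
      ⨁ (λ y → inner y xor outer y) ≡⟨ ⨁-cong (λ y → ∧-splitsˡ (A y) (X y)) ⟨
      ⨁ A                         ≡⟨ xor-solve parity (trans (⨁-cong boundary≡) (handshake G reg outer)) ⟩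
      true                        ∎
      where open ≡-Reasoning

    decide : ∀ b → ⨁ inner ≡ b → OddCut G
    decide true odd-inner = record
      { apex = s ; A = inner ; apex∉A = cong (_∧ X s) s∉A ; closed = inner-touches ; odd-A = odd-inner }
    decide false even-inner = record
      { apex = u ; A = outer ; apex∉A = cong (_∧ not (X u)) u∉A ; closed = outer-touches
      ; odd-A = trans (cong (_xor ⨁ outer) (sym even-inner)) odd-inner-outer }

  resolve : Colorable 3 1 G ⊎ OddCut G
  resolve with s ≟ q
  ... | yes s≡q = inj₂ (common-end s≡q)
  ... | no s≢q with single-edge G reg u≢s g-only
  ...   | inj₁ col = inj₁ col
  ...   | inj₂ (A , obs) with A q in Aq
  ...     | false = inj₂ (split-obstruction s≢q obs Aq)
  -- If `q` lies in the obstruction, the complementary one avoids it.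
  ...     | true  = inj₂ (split-obstruction s≢q (rest-obstruction odd-n u≢s g-only obs)
                            (cong (λ b → not b ∧ (not (q == u) ∧ not (q == s))) Aq))

single-edge⇒colourable⊎cut : ∀ G → Regular 4 G → odd (n G) ≡ true → ∀ {u v f} → u ≢ v → OnlyEdge G u v f →
                             Colorable 3 1 G ⊎ OddCut G
single-edge⇒colourable⊎cut G reg odd-n {u} {v} {f} u≢v only with single-edge G reg u≢v only
... | inj₁ col = inj₁ col
... | inj₂ (A , obs) = choose
  where
  open TwoVertexCuts G reg

  end-in : ∀ {x} B e → B x ≡ false → boundary x B e ≡ true → ∃ λ s → Joins G x s e × B s ≡ true
  end-in {x} B e Bx b with t , crosses ← ∧-true {touches x (ends G e)} b
    with s , y , joins , Bs , By ← crossing B (ends G e) crosses with touched (ends G e) joins t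
  ... | inj₁ refl = contradiction Bx (true≢false Bs)
  ... | inj₂ refl = s , joins-sym joins , Bs

  from-small : ∀ {B} → Obstruction G u v B → count (boundary u B) + count (boundary v B) ≤ 3 → Colorable 3 1 G ⊎ OddCut G
  from-small {B} obsB small with classify u≢v obsB small
  ... | inj₁ cut = inj₂ cut
  ... | inj₂ (cu , cv , even-B)
    with g , bg , g-unique ← count≡1 (boundary u B) cu | h , bh , h-unique ← count≡1 (boundary v B) cv
    with s , g-joins , Bs ← end-in B g (Obstruction.u∉A obsB) bg | q , h-joins , Bq ← end-in B h (Obstruction.v∉A obsB) bh =
    EvenTwoCut.resolve G reg odd-n B even-B u≢v (Obstruction.u∉A obsB) (Obstruction.v∉A obsB) Bs Bq g-joins h-joins
      λ e crosses → [ (λ t → inj₁ (g-unique e (cong₂ _∧_ t crosses))) , (λ t → inj₂ (h-unique e (cong₂ _∧_ t crosses))) ]′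
                      (Obstruction.closed obsB e crosses)

  B : Fin (n G) → Bool
  B = rest u v A
  obsB : Obstruction G u v B
  obsB = rest-obstruction odd-n u≢v only obs
  disjoint : ∀ y → A y ∧ B y ≡ false
  disjoint y with A y
  ... | true  = refl
  ... | false = refl
  choose : Colorable 3 1 G ⊎ OddCut G
  choose with count (boundary u A) + count (boundary v A) ≤? 3 | count (boundary u B) + count (boundary v B) ≤? 3
  ... | yes small | _ = from-small obs small
  ... | no _ | yes small = from-small obsB small
  -- Two large obstructions would need at least eight boundary edges, while `u` and `v` offer three
  -- each besides `f`.
  ... | no big | no big′ = contradiction (≤-trans (+-mono-≤ (≰⇒> big) (≰⇒> big′)) total) (<⇒≱ (s≤s (s≤s (s≤s (s≤s (s≤s (s≤s (s≤s z≤n))))))))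
    where
    total : (count (boundary u A) + count (boundary v A)) + (count (boundary u B) + count (boundary v B)) ≤ 6
    total with bu , bv ← count-boundary-≤ u≢v only obs obsB disjoint =
      ≤-trans (≤-reflexive (+-interchange (count (boundary u A)) (count (boundary v A)) (count (boundary u B)) (count (boundary v B)))) (+-mono-≤ bu bv)

-- Isomorphism invariance

==-injective : ∀ {k l} {f : Fin k → Fin l} → (∀ {x y} → f x ≡ f y → x ≡ y) → ∀ x y → (f x == f y) ≡ (x == y)
==-injective {f = f} inj x y with x ≟ y
... | yes refl = ==-refl (f x)
... | no x≢y = ==-≢ (x≢y ∘ inj)

incid-sameEnds : ∀ {k} (v : Fin k) {p q} → SameEnds p q → incid v p ≡ incid v q
incid-sameEnds v (inj₁ refl) = refl
incid-sameEnds v {q = a , b} (inj₂ refl) = +-comm (bit (b == v)) _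

incid-map : ∀ {k l} {f : Fin k → Fin l} → (∀ {x y} → f x ≡ f y → x ≡ y) → ∀ v p → incid (f v) (map f f p) ≡ incid v p
incid-map inj v (a , b) = cong₂ _+_ (cong bit (==-injective inj a v)) (cong bit (==-injective inj b v))

cross-sameEnds : ∀ {k} (A : Fin k → Bool) {p q} → SameEnds p q → cross A p ≡ cross A q
cross-sameEnds A {p} {a , b} = cross-joins A p

sameEnds-map : ∀ {k l} (f : Fin k → Fin l) {p q} → SameEnds p q → SameEnds (map f f p) (map f f q)
sameEnds-map f (inj₁ refl) = inj₁ refl
sameEnds-map f (inj₂ refl) = inj₂ refl

sameEnds-sym : ∀ {k} {p q : Fin k × Fin k} → SameEnds p q → SameEnds q p
sameEnds-sym (inj₁ refl) = inj₁ refl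
sameEnds-sym (inj₂ refl) = inj₂ refl

iso-sym : ∀ {G H} → Iso G H → Iso H G
iso-sym {G} {H} i = record
  { vmap = Inv.↔-sym vmap ; emap = Inv.↔-sym emap ; ends-pres = pres }
  where
  open Iso i
  module V = Inverse vmap
  module E = Inverse emap
  pres : ∀ e → SameEnds (ends G (E.from e)) (map V.from V.from (ends H e))
  pres e with ends-pres (E.from e)
  ... | same rewrite E.strictlyInverseˡ e with sameEnds-map V.from same
  ...   | same′ rewrite V.strictlyInverseʳ (proj₁ (ends G (E.from e))) | V.strictlyInverseʳ (proj₂ (ends G (E.from e))) =
    sameEnds-sym same′

module _ {G H : Graph} (i : Iso G H) where
  open Iso i
  private
    module V = Inverse vmap
    module E = Inverse emap

  V-injective : ∀ {x y} → V.to x ≡ V.to y → x ≡ y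
  V-injective {x} {y} eq = trans (sym (V.strictlyInverseʳ x)) (trans (cong V.from eq) (V.strictlyInverseʳ y))

  wdeg-iso : ∀ S v → wdeg H S (V.to v) ≡ wdeg G (S ∘ E.to) v
  wdeg-iso S v = trans (sumFin-permute emap _) (sumFin-cong (m G) λ e → cong (λ d → if S (E.to e) then d else 0)
    (trans (incid-sameEnds (V.to v) (ends-pres e)) (incid-map V-injective v (ends G e))))

  colorable-iso : Colorable 3 1 H → Colorable 3 1 G
  colorable-iso (c , (e , _) , balanced) =
    colourable G (c ∘ E.to) (proj₁ (ends G (E.from e))) λ v →
      let x , y , x≢y , dx , dy = balanced (V.to v) in
      x , y , x≢y , trans (sym (wdeg-iso _ v)) dx , trans (sym (wdeg-iso _ v)) dy

  regular-iso : ∀ {r} → Regular r H → Regular r G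
  regular-iso reg v = trans (sym (wdeg-iso (λ _ → true) v)) (reg (V.to v))

  linked-iso : Linked G → Linked H
  linked-iso linked A closed u v =
    subst (λ x → A x ≡ A v) (V.strictlyInverseˡ u)
      (subst (λ y → A (V.to (V.from u)) ≡ A y) (V.strictlyInverseˡ v)
        (linked (A ∘ V.to) (λ e → trans (sym (cross-sameEnds A (ends-pres e))) (closed (E.to e))) (V.from u) (V.from v)))

-- Edge adhesion

module Subdivided (G : Graph) (e₀ : Fin (m G)) {N : ℕ} (i : Fin (n G) → Fin N) (w : Fin N) where

  subdivided-ends : Fin (m G) → Fin N × Fin N
  subdivided-ends e = if e == e₀ then (i (proj₁ (ends G e₀)) , w) else map i i (ends G e)

  private
    if-0 : ∀ b {x} → x ≡ 0 → (if b then x else 0) ≡ 0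
    if-0 b refl = if-eta b

  -- In the subdivision the label `e₀` keeps only the half at its first endpoint. The end lost at
  -- the second endpoint is added on the left, which avoids subtraction.
  sum-inside : (∀ {x y} → i x ≡ i y → x ≡ y) → (∀ x → w ≢ i x) → ∀ S y →
    sumFin (m G) (λ e → if S e then incid (i y) (subdivided-ends e) else 0) + (if S e₀ then bit (proj₂ (ends G e₀) == y) else 0)
    ≡ wdeg G S y
  sum-inside inj w∉ S y = begin
    sumFin (m G) f + t                                             ≡⟨ cong (sumFin (m G) f +_) (sumFin-single (m G) e₀ (λ _ → t)) ⟨
    sumFin (m G) f + sumFin (m G) (λ e → if e == e₀ then t else 0) ≡⟨ sumFin-+ (m G) _ _ ⟨
    sumFin (m G) (λ e → f e + (if e == e₀ then t else 0))          ≡⟨ sumFin-cong (m G) pointwise ⟩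
    wdeg G S y                                                     ∎
    where
    open ≡-Reasoning
    t : ℕ
    t = if S e₀ then bit (proj₂ (ends G e₀) == y) else 0
    f : Fin (m G) → ℕ
    f e = if S e then incid (i y) (subdivided-ends e) else 0
    pointwise : ∀ e → f e + (if e == e₀ then t else 0) ≡ (if S e then incid y (ends G e) else 0)
    pointwise e with e ≟ e₀
    ... | no _ rewrite incid-map inj y (ends G e) = +-identityʳ _
    ... | yes refl with S e₀
    ...   | false = refl
    ...   | true rewrite ==-≢ (w∉ y) | ==-injective inj (proj₁ (ends G e₀)) y =
      cong (_+ bit (proj₂ (ends G e₀) == y)) (+-identityʳ (bit (proj₁ (ends G e₀) == y)))

  sum-outside : ∀ {x} → (∀ y → i y ≢ x) → w ≢ x → ∀ (S : Fin (m G) → Bool) →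
    sumFin (m G) (λ e → if S e then incid x (subdivided-ends e) else 0) ≡ 0
  sum-outside {x} x∉ w≢x S = trans (sumFin-cong (m G) λ e → if-0 (S e) (none e)) (sumFin-0 (m G))
    where
    none : ∀ e → incid x (subdivided-ends e) ≡ 0
    none e with e == e₀
    ... | true  = cong₂ _+_ (cong bit (==-≢ (x∉ _))) (cong bit (==-≢ w≢x))
    ... | false = cong₂ _+_ (cong bit (==-≢ (x∉ _))) (cong bit (==-≢ (x∉ _)))

  sum-apex : (∀ y → i y ≢ w) → ∀ S →
    sumFin (m G) (λ e → if S e then incid w (subdivided-ends e) else 0) ≡ bit (S e₀)
  sum-apex w∉ S = trans (sumFin-cong (m G) pointwise) (sumFin-single (m G) e₀ (bit ∘ S))
    where
    pointwise : ∀ e → (if S e then incid w (subdivided-ends e) else 0) ≡ (if e == e₀ then bit (S e) else 0)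
    pointwise e with e == e₀
    ... | true  = cong (λ d → if S e then d else 0) (cong₂ _+_ (cong bit (==-≢ (w∉ _))) (cong bit (==-refl w)))
    ... | false = if-0 (S e) (cong₂ _+_ (cong bit (==-≢ (w∉ _))) (cong bit (==-≢ (w∉ _))))

module Adhesion (G₁ : Graph) (e₁ : Fin (m G₁)) (G₂ : Graph) (e₂ : Fin (m G₂)) where

  G : Graph
  G = adhesion G₁ e₁ G₂ e₂

  i₁ : Fin (n G₁) → Fin (n G)
  i₁ x = suc (x ↑ˡ n G₂)
  i₂ : Fin (n G₂) → Fin (n G)
  i₂ y = suc (n G₁ ↑ʳ y)
  ι₁ : Fin (m G₁) → Fin (m G)
  ι₁ e = suc (suc (e ↑ˡ m G₂))
  ι₂ : Fin (m G₂) → Fin (m G)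
  ι₂ e = suc (suc (m G₁ ↑ʳ e))
  g₁ g₂ : Fin (m G)
  g₁ = zero
  g₂ = suc zero

  private
    module D₁ = Subdivided G₁ e₁ i₁ zero
    module D₂ = Subdivided G₂ e₂ i₂ zero

  i₁-injective : ∀ {x y} → i₁ x ≡ i₁ y → x ≡ y
  i₁-injective eq = ↑ˡ-injective (n G₂) _ _ (Fin.suc-injective eq)

  i₂-injective : ∀ {x y} → i₂ x ≡ i₂ y → x ≡ y
  i₂-injective eq = ↑ʳ-injective (n G₁) _ _ (Fin.suc-injective eq)

  i₁≢i₂ : ∀ {x y} → i₁ x ≢ i₂ y
  i₁≢i₂ {x} {y} eq with () ← trans (sym (splitAt-↑ˡ (n G₁) x (n G₂)))
    (trans (cong (splitAt (n G₁)) (Fin.suc-injective eq)) (splitAt-↑ʳ (n G₁) (n G₂) y))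

  ends-ι₁ : ∀ e → ends G (ι₁ e) ≡ D₁.subdivided-ends e
  ends-ι₁ e rewrite splitAt-↑ˡ (m G₁) e (m G₂) = refl

  ends-ι₂ : ∀ e → ends G (ι₂ e) ≡ D₂.subdivided-ends e
  ends-ι₂ e rewrite splitAt-↑ʳ (m G₁) (m G₂) e = refl

  vertex-cases : (P : Fin (n G) → Set) → P zero → (∀ x → P (i₁ x)) → (∀ y → P (i₂ y)) → ∀ v → P v
  vertex-cases P p₀ p₁ p₂ zero = p₀
  vertex-cases P p₀ p₁ p₂ (suc v) with splitAt (n G₁) v in eq
  ... | inj₁ x = subst (P ∘ suc) (splitAt⁻¹-↑ˡ eq) (p₁ x)
  ... | inj₂ y = subst (P ∘ suc) (splitAt⁻¹-↑ʳ eq) (p₂ y)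

  edge-cases : (P : Fin (m G) → Set) → P g₁ → P g₂ → (∀ e → P (ι₁ e)) → (∀ e → P (ι₂ e)) → ∀ e → P e
  edge-cases P p₁ p₂ q₁ q₂ zero = p₁
  edge-cases P p₁ p₂ q₁ q₂ (suc zero) = p₂
  edge-cases P p₁ p₂ q₁ q₂ (suc (suc e)) with splitAt (m G₁) e in eq
  ... | inj₁ x = subst (λ k → P (suc (suc k))) (splitAt⁻¹-↑ˡ eq) (q₁ x)
  ... | inj₂ y = subst (λ k → P (suc (suc k))) (splitAt⁻¹-↑ʳ eq) (q₂ y)

  wdeg-sides : ∀ S v → wdeg G S v ≡
    (if S g₁ then incid v (i₁ (proj₂ (ends G₁ e₁)) , zero) else 0) + ((if S g₂ then incid v (i₂ (proj₂ (ends G₂ e₂)) , zero) else 0) +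
    (sumFin (m G₁) (λ e → if S (ι₁ e) then incid v (D₁.subdivided-ends e) else 0) +
     sumFin (m G₂) (λ e → if S (ι₂ e) then incid v (D₂.subdivided-ends e) else 0)))
  wdeg-sides S v = cong (at g₁ +_) (cong (at g₂ +_) (trans (sumFin-↑ (m G₁) (m G₂) λ k → at (suc (suc k)))
    (cong₂ _+_ (sumFin-cong (m G₁) λ e → cong (λ p → if S (ι₁ e) then incid v p else 0) (ends-ι₁ e))
               (sumFin-cong (m G₂) λ e → cong (λ p → if S (ι₂ e) then incid v p else 0) (ends-ι₂ e)))))
    where
    at : Fin (m G) → ℕ
    at e = if S e then incid v (ends G e) else 0

  private
    if-cong : ∀ b {x y : ℕ} → x ≡ y → (if b then x else 0) ≡ (if b then y else 0)
    if-cong b refl = refl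

  -- The end of `e₁` at its second endpoint is exchanged for the end of `g₁` there. If `S` treats
  -- both halves alike, the two corrections cancel.
  wdeg-i₁ : ∀ S y → wdeg G S (i₁ y) + (if S (ι₁ e₁) then bit (proj₂ (ends G₁ e₁) == y) else 0)
                    ≡ wdeg G₁ (S ∘ ι₁) y + (if S g₁ then bit (proj₂ (ends G₁ e₁) == y) else 0)
  wdeg-i₁ S y = begin
    wdeg G S (i₁ y) + t           ≡⟨ cong (_+ t) (wdeg-sides S (i₁ y)) ⟩
    _ + t                         ≡⟨ cong (_+ t) (cong₂ _+_ (if-cong (S g₁) inc₁) (cong₂ _+_ (trans (if-cong (S g₂) inc₂) (if-eta (S g₂)))
                                       (trans (cong₂ _+_ refl (D₂.sum-outside (λ x → i₁≢i₂ ∘ sym) (λ ()) (S ∘ ι₂))) (+-identityʳ Σ₁)))) ⟩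
    s + Σ₁ + t                    ≡⟨ +-assoc s Σ₁ t ⟩
    s + (Σ₁ + t)                  ≡⟨ cong (s +_) (D₁.sum-inside i₁-injective (λ x ()) (S ∘ ι₁) y) ⟩
    s + wdeg G₁ (S ∘ ι₁) y        ≡⟨ +-comm s _ ⟩
    wdeg G₁ (S ∘ ι₁) y + s        ∎
    where
    open ≡-Reasoning
    s t Σ₁ : ℕ
    s = if S g₁ then bit (proj₂ (ends G₁ e₁) == y) else 0
    t = if S (ι₁ e₁) then bit (proj₂ (ends G₁ e₁) == y) else 0
    Σ₁ = sumFin (m G₁) (λ e → if S (ι₁ e) then incid (i₁ y) (D₁.subdivided-ends e) else 0)
    inc₁ : incid (i₁ y) (i₁ (proj₂ (ends G₁ e₁)) , zero) ≡ bit (proj₂ (ends G₁ e₁) == y)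
    inc₁ = trans (+-identityʳ _) (cong bit (==-injective i₁-injective _ y))
    inc₂ : incid (i₁ y) (i₂ (proj₂ (ends G₂ e₂)) , zero) ≡ 0
    inc₂ = trans (+-identityʳ _) (cong bit (==-≢ (i₁≢i₂ ∘ sym)))

  wdeg-i₂ : ∀ S y → wdeg G S (i₂ y) + (if S (ι₂ e₂) then bit (proj₂ (ends G₂ e₂) == y) else 0)
                    ≡ wdeg G₂ (S ∘ ι₂) y + (if S g₂ then bit (proj₂ (ends G₂ e₂) == y) else 0)
  wdeg-i₂ S y = begin
    wdeg G S (i₂ y) + t           ≡⟨ cong (_+ t) (wdeg-sides S (i₂ y)) ⟩
    _ + t                         ≡⟨ cong (_+ t) (cong₂ _+_ (trans (if-cong (S g₁) inc₁) (if-eta (S g₁))) (cong₂ _+_ (if-cong (S g₂) inc₂)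
                                       (cong₂ _+_ (D₁.sum-outside (λ x → i₁≢i₂) (λ ()) (S ∘ ι₁)) (refl {x = Σ₂})))) ⟩
    s + Σ₂ + t                    ≡⟨ +-assoc s Σ₂ t ⟩
    s + (Σ₂ + t)                  ≡⟨ cong (s +_) (D₂.sum-inside i₂-injective (λ x ()) (S ∘ ι₂) y) ⟩
    s + wdeg G₂ (S ∘ ι₂) y        ≡⟨ +-comm s _ ⟩
    wdeg G₂ (S ∘ ι₂) y + s        ∎
    where
    open ≡-Reasoning
    s t Σ₂ : ℕ
    s = if S g₂ then bit (proj₂ (ends G₂ e₂) == y) else 0
    t = if S (ι₂ e₂) then bit (proj₂ (ends G₂ e₂) == y) else 0
    Σ₂ = sumFin (m G₂) (λ e → if S (ι₂ e) then incid (i₂ y) (D₂.subdivided-ends e) else 0)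
    inc₁ : incid (i₂ y) (i₁ (proj₂ (ends G₁ e₁)) , zero) ≡ 0
    inc₁ = trans (+-identityʳ _) (cong bit (==-≢ i₁≢i₂))
    inc₂ : incid (i₂ y) (i₂ (proj₂ (ends G₂ e₂)) , zero) ≡ bit (proj₂ (ends G₂ e₂) == y)
    inc₂ = trans (+-identityʳ _) (cong bit (==-injective i₂-injective _ y))

  wdeg-apex : ∀ S → wdeg G S zero ≡ bit (S g₁) + (bit (S g₂) + (bit (S (ι₁ e₁)) + bit (S (ι₂ e₂))))
  wdeg-apex S = trans (wdeg-sides S zero)
    (cong (bit (S g₁) +_) (cong (bit (S g₂) +_) (cong₂ _+_ (D₁.sum-apex (λ _ ()) (S ∘ ι₁)) (D₂.sum-apex (λ _ ()) (S ∘ ι₂)))))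

  wdeg-i₁-≡ : ∀ S y → S g₁ ≡ S (ι₁ e₁) → wdeg G S (i₁ y) ≡ wdeg G₁ (S ∘ ι₁) y
  wdeg-i₁-≡ S y eq with wdeg-i₁ S y
  ... | sums rewrite eq = +-cancelʳ-≡ _ _ _ sums

  wdeg-i₂-≡ : ∀ S y → S g₂ ≡ S (ι₂ e₂) → wdeg G S (i₂ y) ≡ wdeg G₂ (S ∘ ι₂) y
  wdeg-i₂-≡ S y eq with wdeg-i₂ S y
  ... | sums rewrite eq = +-cancelʳ-≡ _ _ _ sums

  regular₁ : Regular 4 G → Regular 4 G₁
  regular₁ reg y = trans (sym (wdeg-i₁-≡ (λ _ → true) y refl)) (reg (i₁ y))

  -- A closed set of `G₁` is extended over the apex and the whole other side by its value at the
  -- second endpoint of `e₁`. Then only the first half of `e₁` could leave it, and it does so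
  -- exactly if `e₁` did.
  linked₁ : Linked G → Linked G₁
  linked₁ linked A closed u v = trans (sym (Â-i₁ u)) (trans (linked Â Â-closed (i₁ u) (i₁ v)) (Â-i₁ v))
    where
    a : Bool
    a = A (proj₂ (ends G₁ e₁))
    Â : Fin (n G) → Bool
    Â zero    = a
    Â (suc x) = [ A , (λ _ → a) ]′ (splitAt (n G₁) x)
    Â-i₁ : ∀ x → Â (i₁ x) ≡ A x
    Â-i₁ x rewrite splitAt-↑ˡ (n G₁) x (n G₂) = refl
    Â-i₂ : ∀ y → Â (i₂ y) ≡ a
    Â-i₂ y rewrite splitAt-↑ʳ (n G₁) (n G₂) y = refl
    xor-≡ : ∀ {x y} → x ≡ y → x xor y ≡ false
    xor-≡ {x} refl = xor-same x
    closed₁ : ∀ e → cross Â (D₁.subdivided-ends e) ≡ false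
    closed₁ e with e ≟ e₁
    ... | yes refl = trans (cong (_xor a) (Â-i₁ _)) (closed e)
    ... | no _ = trans (cong₂ _xor_ (Â-i₁ _) (Â-i₁ _)) (closed e)
    closed₂ : ∀ e → cross Â (D₂.subdivided-ends e) ≡ false
    closed₂ e with e == e₂
    ... | true = xor-≡ (Â-i₂ _)
    ... | false = xor-≡ (trans (Â-i₂ _) (sym (Â-i₂ _)))
    Â-closed : ∀ e → cross Â (ends G e) ≡ false
    Â-closed = edge-cases _ (xor-≡ (Â-i₁ _)) (xor-≡ (Â-i₂ _))
      (λ e → trans (cong (cross Â) (ends-ι₁ e)) (closed₁ e)) (λ e → trans (cong (cross Â) (ends-ι₂ e)) (closed₂ e))

-- Restricting and extending colourings along an adhesion

≡ᵇ-refl : ∀ k → (k ≡ᵇ k) ≡ true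
≡ᵇ-refl zero    = refl
≡ᵇ-refl (suc k) = ≡ᵇ-refl k

≡ᵇ-suc : ∀ k → (k ≡ᵇ suc k) ≡ false
≡ᵇ-suc zero    = refl
≡ᵇ-suc (suc k) = ≡ᵇ-suc k

suc-≡ᵇ : ∀ k → (suc k ≡ᵇ k) ≡ false
suc-≡ᵇ zero    = refl
suc-≡ᵇ (suc k) = suc-≡ᵇ k

bits-≢ : ∀ a b x → a ≢ b → bit (a ≡ᵇ x) + bit (b ≡ᵇ x) ≤ 1
bits-≢ a b x a≢b with a ≡ᵇ x in ax | b ≡ᵇ x in bx
... | true  | true  = contradiction (trans (≡ᵇ⇒≡ a x (subst T (sym ax) _)) (sym (≡ᵇ⇒≡ b x (subst T (sym bx) _)))) a≢b
... | true  | false = ≤-refl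
... | false | true  = ≤-refl
... | false | false = z≤n

-- A pair bounded by one stands for two edges of different colours. The interleaving follows the
-- order of summation in `wdeg-apex` and in the reassociated `wdeg-next`.
two-bits-≢3 : ∀ a b c d → a + c ≤ 1 → b + d ≤ 1 → a + (b + (c + d)) ≢ 3
two-bits-≢3 a b c d ac bd eq = contradiction (≤-trans (≤-reflexive (sym (trans (sym regroup) eq))) (+-mono-≤ ac bd)) λ { (s≤s (s≤s ())) }
  where
  regroup : a + (b + (c + d)) ≡ (a + c) + (b + d)
  regroup rewrite sym (+-assoc b c d) | +-comm b c | +-assoc c b d = sym (+-assoc a c (b + d))

module AdhesionColouring (G₁ : Graph) (e₁ : Fin (m G₁)) (G₂ : Graph) (e₂ : Fin (m G₂)) where

  open Adhesion G₁ e₁ G₂ e₂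

  -- A monochromatic pair of halves merges into one edge without changing colour degrees on its
  -- side. Two bichromatic pairs would leave each colour at most two edges at the apex, and none
  -- could occur three times.
  colorable-side : Colorable 3 1 G → Colorable 3 1 G₁ ⊎ Colorable 3 1 G₂
  colorable-side (c , _ , balanced) with c g₁ Nat.≟ c (ι₁ e₁) | c g₂ Nat.≟ c (ι₂ e₂)
  ... | yes eq | _ = inj₁ (colourable G₁ (c ∘ ι₁) (proj₁ (ends G₁ e₁)) λ v →
          let x , y , x≢y , dx , dy = balanced (i₁ v) in
          x , y , x≢y , trans (sym (wdeg-i₁-≡ (λ e → c e ≡ᵇ x) v (cong (_≡ᵇ x) eq))) dx , trans (sym (wdeg-i₁-≡ (λ e → c e ≡ᵇ y) v (cong (_≡ᵇ y) eq))) dy)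
  ... | no _ | yes eq = inj₂ (colourable G₂ (c ∘ ι₂) (proj₁ (ends G₂ e₂)) λ v →
          let x , y , x≢y , dx , dy = balanced (i₂ v) in
          x , y , x≢y , trans (sym (wdeg-i₂-≡ (λ e → c e ≡ᵇ x) v (cong (_≡ᵇ x) eq))) dx , trans (sym (wdeg-i₂-≡ (λ e → c e ≡ᵇ y) v (cong (_≡ᵇ y) eq))) dy)
  ... | no ≢₁ | no ≢₂ with x , _ , _ , dx , _ ← balanced zero =
    contradiction (trans (sym (wdeg-apex (λ e → c e ≡ᵇ x))) dx) 
      (two-bits-≢3 (bit (c g₁ ≡ᵇ x)) (bit (c g₂ ≡ᵇ x)) _ _ (bits-≢ (c g₁) (c (ι₁ e₁)) x ≢₁) (bits-≢ (c g₂) (c (ι₂ e₂)) x ≢₂))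

  -- An odd side admits a join that sees the two halves of e₂ differently, so it
  -- extends any colouring of the other side.
  extend-colouring : Regular 4 G → Linked G₂ → odd (n G₂) ≡ true → Colorable 3 1 G₁ → Colorable 3 1 G
  -- Even degree is demanded at one vertex only, the second endpoint of `e₂`; as `n G₂` is odd, this
  -- makes the target sum even. Giving `g₂` the colour opposite to that of the other half of `e₂`
  -- then restores odd degree there.
  extend-colouring reg linked odd-n₂ (c₁ , _ , balanced₁) with join-or-cut G₂ (λ _ → true) (λ y → not (proj₂ (ends G₂ e₂) == y))
  ... | inj₂ (A , closed , A·T) = contradiction (trans (sym A·T) A·T≡false) λ ()
    where
    u : Fin (n G₂)
    u = proj₂ (ends G₂ e₂)
    A·T≡false : ⨁ (λ y → A y ∧ not (u == y)) ≡ false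
    A·T≡false = begin
      ⨁ (λ y → A y ∧ not (u == y))       ≡⟨ ⨁-cong (λ y → cong (_∧ not (u == y)) (linked A (λ e → closed e refl) y u)) ⟩
      ⨁ (λ y → A u ∧ not (u == y))       ≡⟨ ∧-⨁ (A u) _ ⟨
      A u ∧ ⨁ (λ y → true xor (u == y))  ≡⟨ cong (A u ∧_) (⨁-xor (λ _ → true) (u ==_)) ⟩
      A u ∧ (⨁ {n G₂} (λ _ → true) xor ⨁ (u ==_))
        ≡⟨ cong (A u ∧_) (cong₂ _xor_ (trans (⨁-true (n G₂)) odd-n₂) (⨁-single (λ _ → true) u)) ⟩
      A u ∧ false                        ≡⟨ ∧-zeroʳ (A u) ⟩
      false                              ∎
      where open ≡-Reasoning
  ... | inj₁ (J , _ , oddJ) = colourable G c zero (vertex-cases (Balanced G c) balanced-apex balanced-i₁ balanced-i₂)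
    where
    k : ℕ
    -- Both halves of `e₁` have colour `k`, and the halves of `e₂` have `k` and `suc k` in some
    -- order, which makes three and one at the apex.
    k = c₁ e₁
    pick : Bool → ℕ
    pick b = if b then k else suc k
    c : Fin (m G) → ℕ
    c zero          = k
    c (suc zero)    = pick (not (J e₂))
    c (suc (suc e)) = [ c₁ , (λ e → pick (J e)) ]′ (splitAt (m G₁) e)
    c-ι₁ : ∀ e → c (ι₁ e) ≡ c₁ e
    c-ι₁ e rewrite splitAt-↑ˡ (m G₁) e (m G₂) = refl
    c-ι₂ : ∀ e → c (ι₂ e) ≡ pick (J e)
    c-ι₂ e rewrite splitAt-↑ʳ (m G₁) (m G₂) e = refl
    pick≡k : ∀ b → (pick b ≡ᵇ k) ≡ b
    pick≡k true  = ≡ᵇ-refl k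
    pick≡k false = suc-≡ᵇ k
    pick≡suc : ∀ b → (pick b ≡ᵇ suc k) ≡ not b
    pick≡suc true  = ≡ᵇ-suc k
    pick≡suc false = ≡ᵇ-refl k
    is-k : Fin (m G) → Bool
    is-k e = c e ≡ᵇ k
    is-k-ι₂ : ∀ e → is-k (ι₂ e) ≡ J e
    is-k-ι₂ e = trans (cong (_≡ᵇ k) (c-ι₂ e)) (pick≡k (J e))

    balanced-apex : Balanced G c zero
    balanced-apex = k , suc k , 1+n≢n ∘ sym ,
      trans (wdeg-apex (λ e → c e ≡ᵇ k)) (three (≡ᵇ-refl k) (pick≡k (not (J e₂))) (trans (cong (_≡ᵇ k) (c-ι₁ e₁)) (≡ᵇ-refl k)) (is-k-ι₂ e₂)) ,
      trans (wdeg-apex (λ e → c e ≡ᵇ suc k)) (one (≡ᵇ-suc k) (pick≡suc (not (J e₂))) (trans (cong (_≡ᵇ suc k) (c-ι₁ e₁)) (≡ᵇ-suc k))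
        (trans (cong (_≡ᵇ suc k) (c-ι₂ e₂)) (pick≡suc (J e₂))))
      where
      three : ∀ {a b c d j} → a ≡ true → b ≡ not j → c ≡ true → d ≡ j → bit a + (bit b + (bit c + bit d)) ≡ 3
      three {j = true}  refl refl refl refl = refl
      three {j = false} refl refl refl refl = refl
      one : ∀ {a b c d j} → a ≡ false → b ≡ not (not j) → c ≡ false → d ≡ not j → bit a + (bit b + (bit c + bit d)) ≡ 1
      one {j = true}  refl refl refl refl = refl
      one {j = false} refl refl refl refl = refl

    balanced-i₁ : ∀ v → Balanced G c (i₁ v)
    balanced-i₁ v with x , y , x≢y , dx , dy ← balanced₁ v =
      x , y , x≢y , trans (same x) dx , trans (same y) dy
      where
      same : ∀ x → degC G c x (i₁ v) ≡ degC G₁ c₁ x v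
      same x = trans (wdeg-i₁-≡ (λ e → c e ≡ᵇ x) v (cong (_≡ᵇ x) (sym (c-ι₁ e₁)))) (wdeg-cong G₁ v λ e _ → cong (_≡ᵇ x) (c-ι₁ e))

    balanced-i₂ : ∀ v → Balanced G c (i₂ v)
    balanced-i₂ v = balanced-odd G reg c is-k k (suc k) (i₂ v) (1+n≢n ∘ sym) odd-k (λ _ _ → refl)
                      (edge-cases _ (λ _ → two-coloured true refl)
                                    (λ _ → two-coloured (not (J e₂)) refl)
                                    (λ e inc → contradiction (not-incident e) inc)
                                    (λ e _ → two-coloured (J e) (c-ι₂ e)))
      where
      two-coloured : ∀ {x} b → x ≡ pick b → (x ≡ᵇ suc k) ≡ not (x ≡ᵇ k)
      two-coloured b refl = trans (pick≡suc b) (cong not (sym (pick≡k b)))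
      not-incident : ∀ e → incid (i₂ v) (ends G (ι₁ e)) ≡ 0
      not-incident e rewrite ends-ι₁ e with e == e₁
      ... | true  = cong (λ b → bit b + 0) (==-≢ i₁≢i₂)
      ... | false = cong₂ _+_ (cong bit (==-≢ (i₁≢i₂ {proj₁ (ends G₁ e)}))) (cong bit (==-≢ (i₁≢i₂ {proj₂ (ends G₁ e)})))
      balance : ∀ {d d₂ s s₂ j t} → d + (if s then bit t else 0) ≡ d₂ + (if s₂ then bit t else 0) →
                s ≡ j → s₂ ≡ not j → odd d₂ ≡ not t → odd d ≡ true
      balance {d} {d₂} {j = j} {t} eq refl refl odd-d₂
        with trans (sym (odd-+ d _)) (trans (cong odd eq) (odd-+ d₂ _))
      ... | par rewrite odd-d₂ with odd d | j | t
      ...   | true  | _     | _     = refl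
      ...   | false | true  | true  = contradiction par λ ()
      ...   | false | true  | false = contradiction par λ ()
      ...   | false | false | true  = contradiction par λ ()
      ...   | false | false | false = contradiction par λ ()
      odd-k : odd (wdeg G is-k (i₂ v)) ≡ true
      odd-k = balance {d = wdeg G is-k (i₂ v)} {wdeg G₂ (is-k ∘ ι₂) v} (wdeg-i₂ is-k v) (is-k-ι₂ e₂) (pick≡k (not (J e₂)))
                (trans (cong odd (wdeg-cong G₂ v λ e _ → is-k-ι₂ e)) (oddJ v))

-- Double cycles

next : ∀ {j} → Fin (suc j) → Fin (suc j)
next {j} i = suc (toℕ i) mod suc j

toℕ-next : ∀ {j} (i : Fin (suc j)) → (toℕ i < j × toℕ (next i) ≡ suc (toℕ i)) ⊎ (toℕ i ≡ j × toℕ (next i) ≡ 0)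
toℕ-next {j} i with m≤n⇒m<n∨m≡n (s≤s⁻¹ (Fin.toℕ<n i))
... | inj₁ i<j = inj₁ (i<j , trans (Fin.toℕ-fromℕ< _) (m<n⇒m%n≡m (s≤s i<j)))
... | inj₂ i≡j = inj₂ (i≡j , trans (Fin.toℕ-fromℕ< _) (trans (cong (λ k → suc k % suc j) i≡j) (n%n≡0 (suc j))))

next-injective : ∀ {j} {i i′ : Fin (suc j)} → next i ≡ next i′ → i ≡ i′
next-injective {i = i} {i′} eq with toℕ-next i | toℕ-next i′
... | inj₁ (_ , p) | inj₁ (_ , q) = Fin.toℕ-injective (suc-injective (trans (sym p) (trans (cong toℕ eq) q)))
... | inj₁ (_ , p) | inj₂ (_ , q) = contradiction (trans (sym p) (trans (cong toℕ eq) q)) λ ()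
... | inj₂ (_ , p) | inj₁ (_ , q) = contradiction (trans (sym q) (trans (cong toℕ (sym eq)) p)) λ ()
... | inj₂ (p , _) | inj₂ (q , _) = Fin.toℕ-injective (trans p (sym q))

next-surjective : ∀ {j} (k : Fin (suc j)) → ∃ λ i → next i ≡ k
next-surjective {j} zero with toℕ-next (fromℕ j)
... | inj₁ (lt , _) = contradiction lt (<-irrefl (Fin.toℕ-fromℕ j))
... | inj₂ (_ , eq) = fromℕ j , Fin.toℕ-injective eq
next-surjective (suc k) with toℕ-next (inject₁ k)
... | inj₁ (_ , eq) = inject₁ k , Fin.toℕ-injective (trans eq (cong suc (Fin.toℕ-inject₁ k)))
... | inj₂ (eq , _) = contradiction (Fin.toℕ<n k) (<-irrefl (trans (sym (Fin.toℕ-inject₁ k)) eq))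

module DoubleCycle (j : ℕ) where

  N : ℕ
  N = suc j

  ends-↑ˡ : ∀ i → ends (doubleCycle j) (i ↑ˡ N) ≡ (i , next i)
  ends-↑ˡ i rewrite splitAt-↑ˡ N i N = refl

  ends-↑ʳ : ∀ i → ends (doubleCycle j) (N ↑ʳ i) ≡ (i , next i)
  ends-↑ʳ i rewrite splitAt-↑ʳ N N i = refl

  -- Naming the vertex `next i` makes its two positions explicit without a predecessor function. On
  -- one vertex they coincide, and the loop is rightly counted twice.
  sum-at-next : ∀ (S : Fin N → Bool) i → sumFin N (λ k → if S k then incid (next i) (k , next k) else 0) ≡ bit (S (next i)) + bit (S i)
  sum-at-next S i = begin
    sumFin N (λ k → if S k then incid (next i) (k , next k) else 0)
      ≡⟨ sumFin-cong N pointwise ⟩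
    sumFin N (λ k → (if k == next i then bit (S k) else 0) + (if k == i then bit (S k) else 0))
      ≡⟨ sumFin-+ N (λ k → if k == next i then bit (S k) else 0) (λ k → if k == i then bit (S k) else 0) ⟩
    sumFin N (λ k → if k == next i then bit (S k) else 0) + sumFin N (λ k → if k == i then bit (S k) else 0)
      ≡⟨ cong₂ _+_ (sumFin-single N (next i) (bit ∘ S)) (sumFin-single N i (bit ∘ S)) ⟩
    bit (S (next i)) + bit (S i)
      ∎
    where
    open ≡-Reasoning
    pointwise : ∀ k → (if S k then incid (next i) (k , next k) else 0) ≡
                      (if k == next i then bit (S k) else 0) + (if k == i then bit (S k) else 0)
    pointwise k rewrite ==-injective next-injective k i with S k | k == next i | k == i
    ... | true  | true  | true  = refl
    ... | true  | true  | false = refl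
    ... | true  | false | true  = refl
    ... | true  | false | false = refl
    ... | false | true  | true  = refl
    ... | false | true  | false = refl
    ... | false | false | true  = refl
    ... | false | false | false = refl

  wdeg-next : ∀ S i → wdeg (doubleCycle j) S (next i) ≡
              (bit (S (next i ↑ˡ N)) + bit (S (i ↑ˡ N))) + (bit (S (N ↑ʳ next i)) + bit (S (N ↑ʳ i)))
  wdeg-next S i = begin
    wdeg (doubleCycle j) S (next i)
      ≡⟨ sumFin-↑ N N (λ e → if S e then incid (next i) (ends (doubleCycle j) e) else 0) ⟩
    sumFin N (λ k → if S (k ↑ˡ N) then incid (next i) (ends (doubleCycle j) (k ↑ˡ N)) else 0) +
    sumFin N (λ k → if S (N ↑ʳ k) then incid (next i) (ends (doubleCycle j) (N ↑ʳ k)) else 0)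
      ≡⟨ cong₂ _+_ (trans (sumFin-cong N λ k → cong (λ p → if S (k ↑ˡ N) then incid (next i) p else 0) (ends-↑ˡ k)) (sum-at-next (λ k → S (k ↑ˡ N)) i))
                   (trans (sumFin-cong N λ k → cong (λ p → if S (N ↑ʳ k) then incid (next i) p else 0) (ends-↑ʳ k)) (sum-at-next (λ k → S (N ↑ʳ k)) i)) ⟩
    (bit (S (next i ↑ˡ N)) + bit (S (i ↑ˡ N))) + (bit (S (N ↑ʳ next i)) + bit (S (N ↑ʳ i)))
      ∎
    where open ≡-Reasoning

  ⨁-next : ∀ f → ⨁ (f ∘ next {j}) ≡ ⨁ f
  ⨁-next f = begin
    ⨁ (f ∘ next)                              ≡⟨ ⨁-cong (λ i → sym (⨁-single f (next i))) ⟩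
    ⨁ (λ i → ⨁ (λ k → f k ∧ (next i == k)))   ≡⟨ ⨁-comm _ ⟩
    ⨁ (λ k → ⨁ (λ i → f k ∧ (next i == k)))   ≡⟨ ⨁-cong (λ k → trans (sym (∧-⨁ (f k) _)) (trans (cong (f k ∧_) (preimage k)) (∧-identityʳ (f k)))) ⟩
    ⨁ f                                       ∎
    where
    open ≡-Reasoning
    preimage : ∀ k → ⨁ (λ i → next i == k) ≡ true
    preimage k with i , refl ← next-surjective k =
      trans (⨁-cong λ i′ → ==-injective next-injective i′ i) (⨁-== i)

  -- Mixed and monochromatic pairs of parallel edges alternate around the cycle.
  odd-not-colorable : odd N ≡ true → ¬ Colorable 3 1 (doubleCycle j)
  odd-not-colorable odd-N (c , _ , balanced) = contradiction (trans (sym all-true) none) λ ()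
    where
    mixed : Fin N → Bool
    mixed i = not (c (i ↑ˡ N) ≡ᵇ c (N ↑ʳ i))
    -- Some colour occurs three times at `next i`: two monochromatic pairs would contribute an even
    -- number of its edges, and two mixed pairs at most two.
    alternate : ∀ i → mixed i xor mixed (next i) ≡ true
    alternate i with x , y , _ , dx , _ ← balanced (next i) =
      parity-3 (trans (sym (wdeg-next (λ e → c e ≡ᵇ x) i)) dx) (pair i) (pair (next i))
      where
      pair : ∀ k → (mixed k ≡ false × (c (k ↑ˡ N) ≡ᵇ x) ≡ (c (N ↑ʳ k) ≡ᵇ x)) ⊎
                   (mixed k ≡ true × bit (c (k ↑ˡ N) ≡ᵇ x) + bit (c (N ↑ʳ k) ≡ᵇ x) ≤ 1)
      pair k with c (k ↑ˡ N) ≡ᵇ c (N ↑ʳ k) in eq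
      ... | true  = inj₁ (refl , cong (_≡ᵇ x) (≡ᵇ⇒≡ (c (k ↑ˡ N)) _ (subst T (sym eq) _)))
      ... | false = inj₂ (refl , bits-≢ (c (k ↑ˡ N)) (c (N ↑ʳ k)) x λ same → true≢false (trans (cong (_≡ᵇ c (N ↑ʳ k)) same) (≡ᵇ-refl (c (N ↑ʳ k)))) eq)
      parity-3 : ∀ {a b a′ b′ mi mi′} → (bit a′ + bit a) + (bit b′ + bit b) ≡ 3 →
                 (mi ≡ false × a ≡ b) ⊎ (mi ≡ true × bit a + bit b ≤ 1) →
                 (mi′ ≡ false × a′ ≡ b′) ⊎ (mi′ ≡ true × bit a′ + bit b′ ≤ 1) → mi xor mi′ ≡ true
      parity-3 {true} {_} {true} () (inj₁ (refl , refl)) (inj₁ (refl , refl))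
      parity-3 {true} {_} {false} () (inj₁ (refl , refl)) (inj₁ (refl , refl))
      parity-3 {false} {_} {true} () (inj₁ (refl , refl)) (inj₁ (refl , refl))
      parity-3 {false} {_} {false} () (inj₁ (refl , refl)) (inj₁ (refl , refl))
      parity-3 _ (inj₁ (refl , _)) (inj₂ (refl , _)) = refl
      parity-3 _ (inj₂ (refl , _)) (inj₁ (refl , _)) = refl
      parity-3 {a} {b} {a′} {b′} eq (inj₂ (refl , le)) (inj₂ (refl , le′)) =
        contradiction (trans (sym (+-assoc (bit a′) (bit a) _)) eq) (two-bits-≢3 (bit a′) (bit a) (bit b′) (bit b) le′ le)
    -- Around the cycle every pair is counted twice.
    none : ⨁ (λ i → mixed i xor mixed (next i)) ≡ false
    none = trans (⨁-xor mixed (mixed ∘ next)) (trans (cong (⨁ mixed xor_) (⨁-next mixed)) (xor-same (⨁ mixed)))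
    all-true : ⨁ (λ i → mixed i xor mixed (next i)) ≡ true
    all-true = trans (⨁-cong alternate) (trans (⨁-true N) odd-N)

odd-2* : ∀ j → odd (2 * j) ≡ false
odd-2* j = trans (odd-+ j (j + 0)) (trans (cong (λ k → odd j xor odd k) (+-identityʳ j)) (xor-same (odd j)))

InC⇒¬colorable : ∀ {G} → InC G → ¬ Colorable 3 1 G
InC⇒¬colorable (oddDC j) = DoubleCycle.odd-not-colorable (2 * j) (cong not (odd-2* j))
InC⇒¬colorable (adh {G₁} {G₂} p₁ p₂ e₁ e₂) col with AdhesionColouring.colorable-side G₁ e₁ G₂ e₂ col
... | inj₁ col₁ = InC⇒¬colorable p₁ col₁
... | inj₂ col₂ = InC⇒¬colorable p₂ col₂
InC⇒¬colorable (iso p i) col = InC⇒¬colorable p (colorable-iso i col)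

-- Decomposition along an odd cut

bijection : ∀ {k l} (f : Fin k → Fin l) → (∀ {x y} → f x ≡ f y → x ≡ y) → (∀ y → ∃ λ x → f x ≡ y) → Fin k ↔ Fin l
bijection f inj surj = mk↔ₛ′ f (proj₁ ∘ surj) (proj₂ ∘ surj) (λ x → inj (proj₂ (surj (f x))))

∷-injective : ∀ {k} {X : Set} {x : X} {f : Fin k → X} → (∀ i → f i ≢ x) → (∀ {i j} → f i ≡ f j → i ≡ j) →
              ∀ {i j} → (x Vector.∷ f) i ≡ (x Vector.∷ f) j → i ≡ j
∷-injective x∉f inj {zero}  {zero}  eq = refl
∷-injective x∉f inj {zero}  {suc j} eq = contradiction (sym eq) (x∉f j)
∷-injective x∉f inj {suc i} {zero}  eq = contradiction eq (x∉f i)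
∷-injective x∉f inj {suc i} {suc j} eq = cong suc (inj eq)

++-injective : ∀ {k l} {X : Set} {f : Fin k → X} {g : Fin l → X} →
               (∀ {i j} → f i ≡ f j → i ≡ j) → (∀ {i j} → g i ≡ g j → i ≡ j) → (∀ i j → f i ≢ g j) →
               ∀ {i j} → (f Vector.++ g) i ≡ (f Vector.++ g) j → i ≡ j
++-injective {k} inj-f inj-g disj {i} {j} eq with splitAt k i in eqi | splitAt k j in eqj
... | inj₁ x | inj₁ y = trans (sym (splitAt⁻¹-↑ˡ eqi)) (trans (cong (_↑ˡ _) (inj-f eq)) (splitAt⁻¹-↑ˡ eqj))
... | inj₁ x | inj₂ y = contradiction eq (disj x y)
... | inj₂ x | inj₁ y = contradiction (sym eq) (disj y x)
... | inj₂ x | inj₂ y = trans (sym (splitAt⁻¹-↑ʳ eqi)) (trans (cong (k ↑ʳ_) (inj-g eq)) (splitAt⁻¹-↑ʳ eqj))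

++-↑ˡ : ∀ {k l} {X : Set} (f : Fin k → X) (g : Fin l → X) i → (f Vector.++ g) (i ↑ˡ l) ≡ f i
++-↑ˡ {k} {l} f g i rewrite splitAt-↑ˡ k i l = refl

++-↑ʳ : ∀ {k l} {X : Set} (f : Fin k → X) (g : Fin l → X) i → (f Vector.++ g) (k ↑ʳ i) ≡ g i
++-↑ʳ {k} {l} f g i rewrite splitAt-↑ʳ k l i = refl

meets : ∀ {k} → (Fin k → Bool) → Fin k × Fin k → Bool
meets A (a , b) = A a ∨ A b

-- The graph spanned by A, with the two edges from A to w replaced by one new edge e₀.
record Half (G : Graph) (w : Fin (n G)) (A : Fin (n G) → Bool) : Set where
  field
    H          : Graph
    e₀         : Fin (m H)
    vert       : Fin (n H) → Fin (n G)
    vert-inj   : ∀ {x y} → vert x ≡ vert y → x ≡ y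
    vert-sound : ∀ x → A (vert x) ≡ true
    vert-onto  : ∀ v → A v ≡ true → ∃ λ x → vert x ≡ v
    size       : n H ≡ count A
    edge       : Fin (m H) → Fin (m G)
    edge-inj   : ∀ {x y} → edge x ≡ edge y → x ≡ y
    edge-sound : ∀ e → meets A (ends G (edge e)) ≡ true
    extra      : Fin (m G)
    extra-sound : meets A (ends G extra) ≡ true
    edge≢extra : ∀ e → edge e ≢ extra
    edge-onto  : ∀ e → meets A (ends G e) ≡ true → e ≢ extra → ∃ λ x → edge x ≡ e
    ends-extra : SameEnds (ends G extra) (vert (proj₂ (ends H e₀)) , w)
    ends-e₀    : SameEnds (ends G (edge e₀)) (vert (proj₁ (ends H e₀)) , w)
    ends-edge  : ∀ e → e ≢ e₀ → ends G (edge e) ≡ map vert vert (ends H e)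

half : ∀ G w A → A w ≡ false → (∀ e → cross A (ends G e) ≡ true → touches w (ends G e) ≡ true) →
       count (λ e → cross A (ends G e)) ≡ 2 → Half G w A
half G w A Aw closed count≡ with count≡2 _ count≡
... | gu , gv , gu≢gv , cross-gu , cross-gv , cross-only = record
  { H = H ; e₀ = e₀ ; vert = VA.elem ; vert-inj = VA.injective ; vert-sound = VA.sound ; vert-onto = VA.complete
  ; size = VA.size≡ ; edge = EA.elem ; edge-inj = EA.injective ; edge-sound = λ e → proj₁ (∧-true (EA.sound e))
  ; extra = gv ; extra-sound = cross⇒meets (ends G gv) cross-gv
  ; edge≢extra = edge≢gv
  ; edge-onto = λ e me e≢gv → EA.complete e (cong₂ _∧_ me (cong not (==-≢ e≢gv)))
  ; ends-extra = ends-gv ; ends-e₀ = ends-gu ; ends-edge = ends-inner }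
  where
  inner : Fin (m G) → Bool
  inner e = meets A (ends G e) ∧ not (e == gv)
  module VA = Enumeration (enumerate A)
  module EA = Enumeration (enumerate inner)

  cross⇒meets : ∀ p → cross A p ≡ true → meets A p ≡ true
  cross⇒meets (a , b) crosses with A a | A b
  ... | true  | _    = refl
  ... | false | true = refl

  attachment : ∀ e → cross A (ends G e) ≡ true → ∃ λ x → SameEnds (ends G e) (x , w) × A x ≡ true
  attachment e crosses with x , y , joins , Ax , Ay ← crossing A (ends G e) crosses
    with touched (ends G e) joins (closed e crosses)
  ... | inj₁ refl = contradiction Aw (true≢false Ax)
  ... | inj₂ refl = x , joins , Ax

  u v : Fin (n G)
  u = proj₁ (attachment gu cross-gu)
  v = proj₁ (attachment gv cross-gv)

  ρ : Fin (n G) → Fin VA.size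
  ρ x with A x Bool.≟ true
  ... | yes Ax = proj₁ (VA.complete x Ax)
  -- A default outside `A` that is never relevant: an inner edge other than `gu` has both ends in
  -- `A`.
  ... | no _   = proj₁ (VA.complete v (proj₂ (proj₂ (attachment gv cross-gv))))

  elem-ρ : ∀ {x} → A x ≡ true → VA.elem (ρ x) ≡ x
  elem-ρ {x} Ax with A x Bool.≟ true
  ... | yes Ax′ = proj₂ (VA.complete x Ax′)
  ... | no ¬Ax  = contradiction Ax ¬Ax

  gu-inner : inner gu ≡ true
  gu-inner = cong₂ _∧_ (cross⇒meets (ends G gu) cross-gu) (cong not (==-≢ gu≢gv))

  e₀ : Fin EA.size
  e₀ = proj₁ (EA.complete gu gu-inner)

  H : Graph
  H = mkGraph VA.size EA.size λ e → if e == e₀ then (ρ u , ρ v) else map ρ ρ (ends G (EA.elem e))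

  edge≢gv : ∀ e → EA.elem e ≢ gv
  edge≢gv e eq with EA.sound e
  ... | inn rewrite eq | ==-refl gv | ∧-zeroʳ (meets A (ends G gv)) = contradiction inn λ ()

  ends-gv : SameEnds (ends G gv) (VA.elem (proj₂ (ends H e₀)) , w)
  ends-gv rewrite ==-refl e₀ | elem-ρ (proj₂ (proj₂ (attachment gv cross-gv))) = proj₁ (proj₂ (attachment gv cross-gv))

  ends-gu : SameEnds (ends G (EA.elem e₀)) (VA.elem (proj₁ (ends H e₀)) , w)
  ends-gu rewrite ==-refl e₀ | proj₂ (EA.complete gu gu-inner) | elem-ρ (proj₂ (proj₂ (attachment gu cross-gu))) =
    proj₁ (proj₂ (attachment gu cross-gu))

  both-in : ∀ p → meets A p ≡ true → cross A p ≡ false → A (proj₁ p) ≡ true × A (proj₂ p) ≡ true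
  both-in (a , b) me nc with A a | A b
  ... | true  | true  = refl , refl
  ... | true  | false = contradiction nc λ ()
  ... | false | true  = contradiction nc λ ()
  ... | false | false = contradiction me λ ()

  ends-inner : ∀ e → e ≢ e₀ → ends G (EA.elem e) ≡ map VA.elem VA.elem (ends H e)
  ends-inner e e≢e₀ rewrite ==-≢ e≢e₀ with cross A (ends G (EA.elem e)) in crosses
  ... | true with cross-only _ crosses
  ...   | inj₁ eq = contradiction (EA.injective (trans eq (sym (proj₂ (EA.complete gu gu-inner))))) e≢e₀
  ...   | inj₂ eq = contradiction eq (edge≢gv e)
  ends-inner e e≢e₀ | false
    with Aa , Ab ← both-in (ends G (EA.elem e)) (proj₁ (∧-true (EA.sound e))) crosses =
    sym (cong₂ _,_ (elem-ρ Aa) (elem-ρ Ab))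

-- In a `Half`, `edge e₀` is attached at the first endpoint of `e₀` and `extra` at the second, which
-- is the convention of `adhesion`; the four kinds of edges therefore match one by one.
assemble : ∀ G {w A B} (h₁ : Half G w A) (h₂ : Half G w B) → A w ≡ false → B w ≡ false →
           (∀ v → v ≢ w → A v ≡ false → B v ≡ true) → (∀ v → A v ≡ true → B v ≡ false) →
           (∀ e → meets A (ends G e) ≡ false → meets B (ends G e) ≡ true) →
           (∀ e → meets A (ends G e) ≡ true → meets B (ends G e) ≡ false) →
           Iso (adhesion (Half.H h₁) (Half.e₀ h₁) (Half.H h₂) (Half.e₀ h₂)) G
assemble G {w} {A} {B} h₁ h₂ Aw Bw coverV disjV coverE disjE = record
  { vmap = bijection vto vto-inj vto-onto ; emap = bijection eto eto-inj eto-onto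
  ; ends-pres = edge-cases (λ e → SameEnds (ends G (eto e)) (map vto vto (ends (adhesion H₁.H H₁.e₀ H₂.H H₂.e₀) e)))
      (pres-extra H₁.ends-extra (vto-i₁ _)) (pres-extra H₂.ends-extra (vto-i₂ _)) pres₁ pres₂ }
  where
  module H₁ = Half h₁
  module H₂ = Half h₂
  open Adhesion H₁.H H₁.e₀ H₂.H H₂.e₀ hiding (G)

  vto : Fin (suc (n H₁.H + n H₂.H)) → Fin (n G)
  vto = w Vector.∷ (H₁.vert Vector.++ H₂.vert)

  eto : Fin (2 + (m H₁.H + m H₂.H)) → Fin (m G)
  eto = H₁.extra Vector.∷ (H₂.extra Vector.∷ (H₁.edge Vector.++ H₂.edge))

  vto-i₁ : ∀ x → vto (i₁ x) ≡ H₁.vert x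
  vto-i₁ = ++-↑ˡ H₁.vert H₂.vert
  vto-i₂ : ∀ x → vto (i₂ x) ≡ H₂.vert x
  vto-i₂ = ++-↑ʳ H₁.vert H₂.vert

  apart : ∀ {k} {P Q : Fin k → Bool} {x y} → P x ≡ true → Q y ≡ true → (∀ z → P z ≡ true → Q z ≡ false) → x ≢ y
  apart Px Qy disj refl = true≢false Qy (disj _ Px)

  not-apex : ∀ {P : Fin (n G) → Bool} {x} → P w ≡ false → P x ≡ true → x ≢ w
  not-apex Pw Px refl = true≢false Px Pw

  ++-avoids : ∀ {k l} {X : Set} {f : Fin k → X} {g : Fin l → X} {x} → (∀ i → f i ≢ x) → (∀ i → g i ≢ x) →
              ∀ i → (f Vector.++ g) i ≢ x
  ++-avoids {k} x∉f x∉g i with splitAt k i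
  ... | inj₁ j = x∉f j
  ... | inj₂ j = x∉g j

  vto-inj : ∀ {x y} → vto x ≡ vto y → x ≡ y
  vto-inj = ∷-injective (++-avoids (λ i → not-apex Aw (H₁.vert-sound i)) (λ i → not-apex Bw (H₂.vert-sound i)))
              (++-injective H₁.vert-inj H₂.vert-inj λ i j → apart (H₁.vert-sound i) (H₂.vert-sound j) disjV)

  mA mB : Fin (m G) → Bool
  mA e = meets A (ends G e)
  mB e = meets B (ends G e)

  eto-inj : ∀ {x y} → eto x ≡ eto y → x ≡ y
  eto-inj = ∷-injective avoids-g₁ (∷-injective avoids-g₂ (++-injective H₁.edge-inj H₂.edge-inj
              λ i j → apart {P = mA} {mB} (H₁.edge-sound i) (H₂.edge-sound j) disjE))
    where
    avoids-g₂ : ∀ i → (H₁.edge Vector.++ H₂.edge) i ≢ H₂.extra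
    avoids-g₂ = ++-avoids (λ i → apart {P = mA} {mB} (H₁.edge-sound i) H₂.extra-sound disjE) H₂.edge≢extra
    avoids-g₁ : ∀ i → (H₂.extra Vector.∷ (H₁.edge Vector.++ H₂.edge)) i ≢ H₁.extra
    avoids-g₁ zero    = apart {P = mA} {mB} H₁.extra-sound H₂.extra-sound disjE ∘ sym
    avoids-g₁ (suc i) = ++-avoids H₁.edge≢extra (λ i → apart {P = mA} {mB} H₁.extra-sound (H₂.edge-sound i) disjE ∘ sym) i

  vto-onto : ∀ v → ∃ λ x → vto x ≡ v
  vto-onto v with v ≟ w | A v in Av
  ... | yes refl | _ = zero , refl
  ... | no _ | true with x , refl ← H₁.vert-onto v Av = i₁ x , vto-i₁ x
  ... | no v≢w | false with x , refl ← H₂.vert-onto v (coverV v v≢w Av) = i₂ x , vto-i₂ x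

  eto-onto : ∀ e → ∃ λ x → eto x ≡ e
  eto-onto e with e ≟ H₁.extra | e ≟ H₂.extra | meets A (ends G e) in Ae
  ... | yes refl | _ | _ = zero , refl
  ... | no _ | yes refl | _ = suc zero , refl
  ... | no ≢₁ | no _ | true with x , refl ← H₁.edge-onto e Ae ≢₁ = ι₁ x , ++-↑ˡ H₁.edge H₂.edge x
  ... | no _ | no ≢₂ | false with x , refl ← H₂.edge-onto e (coverE e Ae) ≢₂ = ι₂ x , ++-↑ʳ H₁.edge H₂.edge x

  pres-extra : ∀ {e x y} → SameEnds (ends G e) (y , w) → x ≡ y → SameEnds (ends G e) (x , w)
  pres-extra same refl = same

  pres₁ : ∀ e → SameEnds (ends G (eto (ι₁ e))) (map vto vto (ends (adhesion H₁.H H₁.e₀ H₂.H H₂.e₀) (ι₁ e)))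
  pres₁ e rewrite ends-ι₁ e | ++-↑ˡ H₁.edge H₂.edge e with e ≟ H₁.e₀
  ... | yes refl = pres-extra {x = vto (i₁ _)} H₁.ends-e₀ (vto-i₁ _)
  ... | no e≢e₀ = inj₁ (trans (H₁.ends-edge e e≢e₀) (sym (cong₂ _,_ (vto-i₁ _) (vto-i₁ _))))

  pres₂ : ∀ e → SameEnds (ends G (eto (ι₂ e))) (map vto vto (ends (adhesion H₁.H H₁.e₀ H₂.H H₂.e₀) (ι₂ e)))
  pres₂ e rewrite ends-ι₂ e | ++-↑ʳ H₁.edge H₂.edge e with e ≟ H₂.e₀
  ... | yes refl = pres-extra {x = vto (i₂ _)} H₂.ends-e₀ (vto-i₂ _)
  ... | no e≢e₀ = inj₁ (trans (H₂.ends-edge e e≢e₀) (sym (cong₂ _,_ (vto-i₂ _) (vto-i₂ _))))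

-- Both orders of the two parts are recorded because regularity, linkedness and the extension of
-- colourings are proved for the first summand of an adhesion; the second is reached by exchanging
-- the two.
record Decomposition (G : Graph) : Set where
  field
    G₁ G₂  : Graph
    e₁     : Fin (m G₁)
    e₂     : Fin (m G₂)
    iso₁₂  : Iso (adhesion G₁ e₁ G₂ e₂) G
    iso₂₁  : Iso (adhesion G₂ e₂ G₁ e₁) G
    odd-n₁ : odd (n G₁) ≡ true
    odd-n₂ : odd (n G₂) ≡ true

module CutDecomposition (G : Graph) (reg : Regular 4 G) (linked : Linked G) (odd-n : odd (n G) ≡ true) (cut : OddCut G) where

  open OddCut cut renaming (apex to w; apex∉A to Aw)

  B : Fin (n G) → Bool
  B y = not (A y) ∧ not (y == w)

  Bw : B w ≡ false
  Bw rewrite ==-refl w = ∧-zeroʳ (not (A w))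

  B≡ : ∀ y → B y ≡ A y xor not (y == w)
  B≡ y with y ≟ w
  ... | yes refl rewrite Aw = refl
  ... | no _ with A y
  ...   | true  = refl
  ...   | false = refl

  disjoint : ∀ y → A y ≡ true → B y ≡ false
  disjoint y Ay rewrite Ay = refl

  covering : ∀ y → y ≢ w → A y ≡ false → B y ≡ true
  covering y y≢w Ay rewrite Ay | ==-≢ y≢w = refl

  closed-B : ∀ e → cross B (ends G e) ≡ true → touches w (ends G e) ≡ true
  closed-B e crosses with touches w (ends G e) in t
  ... | true  = refl
  ... | false = contradiction (closed e (trans (sym (away (ends G e) t)) crosses)) λ eq → true≢false eq t
    where
    away : ∀ p → touches w p ≡ false → cross B p ≡ cross A p
    away p@(a , b) t with a≢w , b≢w ← avoids p t rewrite ==-≢ a≢w | ==-≢ b≢w | ∧-identityʳ (not (A a)) | ∧-identityʳ (not (A b)) =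
      xor-annihilates-not (A a) (A b)

  odd-B : ⨁ B ≡ true
  odd-B = trans (⨁-cong B≡) (trans (⨁-xor A (λ y → true xor (y == w)))
    (cong₂ _xor_ odd-A (trans (⨁-xor (λ _ → true) (_== w)) (cong₂ _xor_ (trans (⨁-true (n G)) odd-n) (⨁-== w)))))

  leaving : (Fin (n G) → Bool) → Fin (m G) → Bool
  leaving P e = cross P (ends G e)

  even-leaving : ∀ P → odd (count (leaving P)) ≡ false
  even-leaving P = trans (odd-count (leaving P)) (handshake G reg P)

  some-leaving : ∀ P → P w ≡ false → ⨁ P ≡ true → count (leaving P) ≢ 0
  some-leaving P Pw odd-P none = contradiction (⨁-false (λ y → trans (linked P (count≡0 (leaving P) none) y w) Pw)) (true≢false odd-P)

  leaving-≤ : ∀ e → bit (leaving A e) + bit (leaving B e) ≤ incid w (ends G e)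
  leaving-≤ e = bound (ends G e) (closed e) (closed-B e)
    where
    bound : ∀ p → (cross A p ≡ true → touches w p ≡ true) → (cross B p ≡ true → touches w p ≡ true) →
            bit (cross A p) + bit (cross B p) ≤ incid w p
    bound (a , b) clA clB with a ≟ w | b ≟ w
    ... | yes refl | yes refl rewrite xor-same (A w) | xor-same (not (A w) ∧ false) = z≤n
    ... | yes refl | no _ rewrite Aw with A b
    ...   | true  = ≤-refl
    ...   | false = ≤-refl
    bound (a , b) clA clB | no _ | yes refl rewrite Aw with A a
    ...   | true  = ≤-refl
    ...   | false = ≤-refl
    bound (a , b) clA clB | no _ | no _ with A a | A b
    ... | true  | true  = z≤n
    ... | true  | false = contradiction (clA refl) λ ()
    ... | false | true  = contradiction (clA refl) λ ()
    ... | false | false = z≤n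

  two-two : ∀ a b → odd a ≡ false → odd b ≡ false → a ≢ 0 → b ≢ 0 → a + b ≤ 4 → a ≡ 2 × b ≡ 2
  two-two 0 b _ _ a≢0 _ _ = contradiction refl a≢0
  two-two a 0 _ _ _ b≢0 _ = contradiction refl b≢0
  two-two 2 2 _ _ _ _ _ = refl , refl
  two-two (suc (suc (suc (suc a)))) (suc b) _ _ _ _ (s≤s (s≤s (s≤s (s≤s le)))) with () ← ≤-trans (≤-reflexive (sym (+-suc a b))) le
  two-two 2 (suc (suc (suc b))) _ _ _ _ (s≤s (s≤s (s≤s (s≤s ()))))

  -- Either side is left by an even number of edges, as every cut is, and by at least one, as `G` is
  -- linked. All these edges use ends at `w`, and there are only four.
  counts : count (leaving A) ≡ 2 × count (leaving B) ≡ 2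
  counts = two-two _ _ (even-leaving A) (even-leaving B) (some-leaving A Aw odd-A) (some-leaving B Bw odd-B)
    (≤-trans (≤-reflexive (sym (sumFin-+ (m G) (bit ∘ leaving A) (bit ∘ leaving B)))) (≤-trans (sumFin-mono (m G) leaving-≤) (≤-reflexive (reg w))))

  -- The four ends at `w` are now all accounted for, so the bound is attained at each edge. In
  -- particular `w` has no loop, which would belong to neither half.
  leaving-≡ : ∀ e → bit (leaving A e) + bit (leaving B e) ≡ incid w (ends G e)
  leaving-≡ = sumFin-mono-≡ (m G) leaving-≤
    (trans (sumFin-+ (m G) (bit ∘ leaving A) (bit ∘ leaving B)) (trans (cong₂ _+_ (proj₁ counts) (proj₂ counts)) (sym (reg w))))

  meets-cover : ∀ e → meets A (ends G e) ≡ false → meets B (ends G e) ≡ true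
  meets-cover e = cover (ends G e) (leaving-≡ e)
    where
    cover : ∀ p → bit (cross A p) + bit (cross B p) ≡ incid w p → meets A p ≡ false → meets B p ≡ true
    cover (a , b) eq none with a ≟ w | b ≟ w | A a in Aa | A b in Ab
    ... | yes refl | yes refl | false | false = contradiction eq λ ()
    ... | yes _ | no _ | false | false = refl
    ... | no _ | _ | false | false = refl

  meets-disjoint : ∀ e → meets A (ends G e) ≡ true → meets B (ends G e) ≡ false
  meets-disjoint e = disj (ends G e) (closed e)
    where
    disj : ∀ p → (cross A p ≡ true → touches w p ≡ true) → meets A p ≡ true → meets B p ≡ false
    disj (a , b) cl me with a ≟ w | b ≟ w
    ... | yes refl | yes refl rewrite Aw = contradiction me λ ()
    ... | yes refl | no _ rewrite Aw | me = refl
    ... | no _ | yes refl rewrite Aw with true ← A a = refl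
    ... | no _ | no _ with A a | A b
    ...   | true  | true  = refl
    ...   | true  | false = contradiction (cl refl) λ ()
    ...   | false | true  = contradiction (cl refl) λ ()

  half-A : Half G w A
  half-A = half G w A Aw closed (proj₁ counts)
  half-B : Half G w B
  half-B = half G w B Bw closed-B (proj₂ counts)

  false⇒ : ∀ {P Q : Bool} → (P ≡ true → Q ≡ false) → Q ≡ true → P ≡ false
  false⇒ {false} _ _ = refl
  false⇒ {true} imp Q = contradiction (imp refl) (true≢false Q)

  decomposition : Decomposition G
  decomposition = record
    { G₁ = Half.H half-A ; G₂ = Half.H half-B ; e₁ = Half.e₀ half-A ; e₂ = Half.e₀ half-B
    ; iso₁₂ = assemble G half-A half-B Aw Bw covering disjoint meets-cover meets-disjoint
    ; iso₂₁ = assemble G half-B half-A Bw Aw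
        (λ v v≢w Bv → ¬-not λ Av → true≢false (covering v v≢w Av) Bv) (λ v → false⇒ (disjoint v))
        (λ e Be → ¬-not λ Ae → true≢false (meets-cover e Ae) Be) (λ e → false⇒ (meets-disjoint e))
    ; odd-n₁ = trans (cong odd (Half.size half-A)) (trans (odd-count A) odd-A)
    ; odd-n₂ = trans (cong odd (Half.size half-B)) (trans (odd-count B) odd-B) }

adhesion-step : ∀ {G} → Regular 4 G → Linked G → (d : Decomposition G) →
  (∀ H → n H < n G → Regular 4 H → Linked H → odd (n H) ≡ true → Colorable 3 1 H ⊎ InC H) →
  Colorable 3 1 G ⊎ InC G
adhesion-step {G} reg linked d ih = combine (ih G₁ n₁<n reg₁ linked₁ odd-n₁) (ih G₂ n₂<n reg₂ linked₂ odd-n₂)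
  where
  open Decomposition d
  module L = Adhesion G₁ e₁ G₂ e₂
  module R = Adhesion G₂ e₂ G₁ e₁
  size : n G ≡ suc (n G₁ + n G₂)
  size = sym (Perm.↔⇒≡ (Iso.vmap iso₁₂))
  n₁<n : n G₁ < n G
  n₁<n = subst (n G₁ <_) (sym size) (s≤s (m≤m+n _ _))
  n₂<n : n G₂ < n G
  n₂<n = subst (n G₂ <_) (sym size) (s≤s (m≤n+m _ _))
  regL : Regular 4 L.G
  regL = regular-iso iso₁₂ reg
  regR : Regular 4 R.G
  regR = regular-iso iso₂₁ reg
  reg₁ : Regular 4 G₁
  reg₁ = L.regular₁ regL
  reg₂ : Regular 4 G₂
  reg₂ = R.regular₁ regR
  linked₁ : Linked G₁
  linked₁ = L.linked₁ (linked-iso (iso-sym iso₁₂) linked)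
  linked₂ : Linked G₂
  linked₂ = R.linked₁ (linked-iso (iso-sym iso₂₁) linked)
  combine : Colorable 3 1 G₁ ⊎ InC G₁ → Colorable 3 1 G₂ ⊎ InC G₂ → Colorable 3 1 G ⊎ InC G
  combine (inj₁ col) _ = inj₁ (colorable-iso (iso-sym iso₁₂) (AdhesionColouring.extend-colouring G₁ e₁ G₂ e₂ regL linked₂ odd-n₂ col))
  combine (inj₂ _) (inj₁ col) = inj₁ (colorable-iso (iso-sym iso₂₁) (AdhesionColouring.extend-colouring G₂ e₂ G₁ e₁ regR linked₁ odd-n₁ col))
  combine (inj₂ p₁) (inj₂ p₂) = inj₂ (iso (adh p₁ p₂ e₁ e₂) iso₁₂)

-- Recognising odd double cycles

∀-⊎ : ∀ {k} {P : Set} {Q : Fin k → Set} → (∀ i → P ⊎ Q i) → P ⊎ (∀ i → Q i)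
∀-⊎ {zero} f = inj₂ λ ()
∀-⊎ {suc k} f with f zero | ∀-⊎ (f ∘ suc)
... | inj₁ p | _      = inj₁ p
... | inj₂ _ | inj₁ p = inj₁ p
... | inj₂ q | inj₂ r = inj₂ λ { zero → q ; (suc i) → r i }

-- The indicator of the four edges lies below `f` and has the same sum, so it equals `f`.
support-of-4 : ∀ {k} (f : Fin k → ℕ) {e₁ e₂ e₃ e₄} → sumFin k f ≡ 4 →
  e₁ ≢ e₂ → e₁ ≢ e₃ → e₁ ≢ e₄ → e₂ ≢ e₃ → e₂ ≢ e₄ → e₃ ≢ e₄ →
  1 ≤ f e₁ → 1 ≤ f e₂ → 1 ≤ f e₃ → 1 ≤ f e₄ →
  ∀ e → f e ≢ 0 → (e ≡ e₁ ⊎ e ≡ e₂) ⊎ (e ≡ e₃ ⊎ e ≡ e₄)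
support-of-4 {k} f {e₁} {e₂} {e₃} {e₄} Σf≡4 12≢ 13≢ 14≢ 23≢ 24≢ 34≢ f₁ f₂ f₃ f₄ e fe≢0 = locate
  where
  at : Fin k → Fin k → ℕ
  at e i = bit (i == e)
  g : Fin k → ℕ
  g i = (at e₁ i + at e₂ i) + (at e₃ i + at e₄ i)
  at-other : ∀ {e i} → i ≢ e → at e i ≡ 0
  at-other i≢e = cong bit (==-≢ i≢e)
  g≤f : ∀ i → g i ≤ f i
  g≤f i with i ≟ e₁ | i ≟ e₂ | i ≟ e₃ | i ≟ e₄
  ... | yes refl | yes refl | _ | _ = contradiction refl 12≢
  ... | yes refl | _ | yes refl | _ = contradiction refl 13≢
  ... | yes refl | _ | _ | yes refl = contradiction refl 14≢
  ... | _ | yes refl | yes refl | _ = contradiction refl 23≢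
  ... | _ | yes refl | _ | yes refl = contradiction refl 24≢
  ... | _ | _ | yes refl | yes refl = contradiction refl 34≢
  ... | yes refl | no _ | no _ | no _ = f₁
  ... | no _ | yes refl | no _ | no _ = f₂
  ... | no _ | no _ | yes refl | no _ = f₃
  ... | no _ | no _ | no _ | yes refl = f₄
  ... | no _ | no _ | no _ | no _ = z≤n
  Σat : ∀ e → sumFin k (at e) ≡ 1
  Σat e = sumFin-single k e (λ _ → 1)
  Σg≡4 : sumFin k g ≡ 4
  Σg≡4 = trans (sumFin-+ k (λ i → at e₁ i + at e₂ i) (λ i → at e₃ i + at e₄ i))
    (cong₂ _+_ (trans (sumFin-+ k (at e₁) (at e₂)) (cong₂ _+_ (Σat e₁) (Σat e₂)))
               (trans (sumFin-+ k (at e₃) (at e₄)) (cong₂ _+_ (Σat e₃) (Σat e₄))))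
  g≡f : ∀ i → g i ≡ f i
  g≡f = sumFin-mono-≡ k g≤f (trans Σg≡4 (sym Σf≡4))
  locate : (e ≡ e₁ ⊎ e ≡ e₂) ⊎ (e ≡ e₃ ⊎ e ≡ e₄)
  locate with e ≟ e₁ | e ≟ e₂ | e ≟ e₃ | e ≟ e₄
  ... | yes p | _ | _ | _ = inj₁ (inj₁ p)
  ... | no _ | yes p | _ | _ = inj₁ (inj₂ p)
  ... | no _ | no _ | yes p | _ = inj₂ (inj₁ p)
  ... | no _ | no _ | no _ | yes p = inj₂ (inj₂ p)
  ... | no ≢₁ | no ≢₂ | no ≢₃ | no ≢₄ = contradiction
    (trans (sym (g≡f e)) (cong₂ _+_ (cong₂ _+_ (at-other ≢₁) (at-other ≢₂)) (cong₂ _+_ (at-other ≢₃) (at-other ≢₄)))) fe≢0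

record TwoNeighbours (G : Graph) (v : Fin (n G)) : Set where
  field
    l r         : Fin (n G)
    l≢v         : l ≢ v
    r≢v         : r ≢ v
    l≢r         : l ≢ r
    el el′      : Fin (m G)
    er er′      : Fin (m G)
    el≢el′      : el ≢ el′
    er≢er′      : er ≢ er′
    el-joins    : Joins G v l el
    el′-joins   : Joins G v l el′
    er-joins    : Joins G v r er
    er′-joins   : Joins G v r er′
    only        : ∀ e → touches v (ends G e) ≡ true → (e ≡ el ⊎ e ≡ el′) ⊎ (e ≡ er ⊎ e ≡ er′)

touches⇒incid : ∀ {k} (v : Fin k) p → touches v p ≡ true → incid v p ≢ 0
touches⇒incid v (a , b) t with a ≟ v | b ≟ v
... | yes _ | _     = λ ()
... | no _  | yes _ = λ ()
touches⇒incid v (a , b) () | no _ | no _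

Mates : Graph → Set
Mates G = ∀ x y f → x ≢ y → Joins G x y f → ∃ λ e → Joins G x y e × e ≢ f

joins? : ∀ G x y e → Dec (Joins G x y e)
joins? G x y e = ≡-dec _≟_ _≟_ (ends G e) (x , y) ⊎-dec ≡-dec _≟_ _≟_ (ends G e) (y , x)

single-or-mates : ∀ G → (∃ λ u → ∃₂ λ v f → u ≢ v × OnlyEdge G u v f) ⊎ Mates G
single-or-mates G with any? (λ f → ¬? (proj₁ (ends G f) ≟ proj₂ (ends G f)) ×-dec
                                    all? (λ e → joins? G (proj₁ (ends G f)) (proj₂ (ends G f)) e →-dec (e ≟ f)))
... | yes (f , a≢b , only) = inj₁ (_ , _ , f , a≢b , inj₁ refl , only)
... | no none = inj₂ mates
  where
  canonical : ∀ f → proj₁ (ends G f) ≢ proj₂ (ends G f) →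
              ∃ λ e → Joins G (proj₁ (ends G f)) (proj₂ (ends G f)) e × e ≢ f
  canonical f a≢b with any? (λ e → joins? G (proj₁ (ends G f)) (proj₂ (ends G f)) e ×-dec ¬? (e ≟ f))
  ... | yes found = found
  ... | no ¬found = contradiction (f , a≢b , stable) none
    where
    stable : ∀ e → Joins G (proj₁ (ends G f)) (proj₂ (ends G f)) e → e ≡ f
    stable e j with e ≟ f
    ... | yes e≡f = e≡f
    ... | no e≢f = contradiction (e , j , e≢f) ¬found
  mates : Mates G
  mates x y f x≢y (inj₁ eq) with canonical f (λ a≡b → x≢y (trans (sym (cong proj₁ eq)) (trans a≡b (cong proj₂ eq))))
  ... | e , j , e≢f = e , subst (SameEnds (ends G e)) eq j , e≢f
  mates x y f x≢y (inj₂ eq) with canonical f (λ a≡b → x≢y (trans (sym (cong proj₂ eq)) (trans (sym a≡b) (cong proj₁ eq))))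
  ... | e , j , e≢f = e , joins-sym (subst (SameEnds (ends G e)) eq j) , e≢f

-- If all edges leaving `v` go to a single vertex `y`, then `v` alone is an odd set with apex `y`.
-- Otherwise edges to two neighbours, together with their mates, exhaust degree four and leave no
-- room for a loop.
two-neighbours : ∀ G → Regular 4 G → Mates G → Linked G → ∀ v → (∃ λ u → u ≢ v) → OddCut G ⊎ TwoNeighbours G v
two-neighbours G reg mates linked v (u , u≢v) with any? (λ e → cross (_== v) (ends G e) Bool.≟ true)
... | no none = contradiction (==⇒≡ (trans (linked (_== v) (λ e → ¬-not λ c → none (e , c)) u v) (==-refl v))) u≢v
... | yes (e₁ , c₁) with crossing (_== v) (ends G e₁) c₁
...   | v′ , y , j₁ , v′≡v , y≢v with refl ← ==⇒≡ {i = v′} v′≡v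
  with any? (λ e → cross (_== v) (ends G e) ∧ not (touches y (ends G e)) Bool.≟ true)
... | no none = inj₁ record
  { apex = y ; A = _== v ; apex∉A = y≢v ; odd-A = ⨁-== v
  ; closed = λ e c → ¬-not λ t → none (e , cong₂ _∧_ c (cong not t)) }
... | yes (e₃ , c₃) with ∧-true {cross (_== v) (ends G e₃)} c₃
...   | c₃′ , nty with crossing (_== v) (ends G e₃) c₃′
...     | v″ , z , j₃ , v″≡v , z≢v with refl ← ==⇒≡ {i = v″} v″≡v
  with mates v y e₁ (λ { refl → true≢false (==-refl v) y≢v }) j₁ | mates v z e₃ (λ { refl → true≢false (==-refl v) z≢v }) j₃
... | e₂ , j₂ , e₂≢e₁ | e₄ , j₄ , e₄≢e₃ = inj₂ record
  { l = y ; r = z ; l≢v = y≢v′ ; r≢v = λ { refl → true≢false (==-refl v) z≢v } ; l≢r = y≢z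
  ; el = e₁ ; el′ = e₂ ; er = e₃ ; er′ = e₄ ; el≢el′ = e₂≢e₁ ∘ sym ; er≢er′ = e₄≢e₃ ∘ sym
  ; el-joins = j₁ ; el′-joins = j₂ ; er-joins = j₃ ; er′-joins = j₄
  ; only = λ e t → support-of-4 (λ e → incid v (ends G e)) (reg v) (e₂≢e₁ ∘ sym) (apart j₁ j₃) (apart j₁ j₄) (apart j₂ j₃) (apart j₂ j₄) (e₄≢e₃ ∘ sym)
             (positive e₁ j₁) (positive e₂ j₂) (positive e₃ j₃) (positive e₄ j₄) e (touches⇒incid v (ends G e) t) }
  where
  y≢v′ : y ≢ v
  y≢v′ refl = true≢false (==-refl v) y≢v
  y≢z : y ≢ z
  y≢z refl = contradiction nty λ eq → contradiction (trans (sym eq) (cong not (touches-joinsʳ (ends G e₃) j₃))) λ ()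
  apart : ∀ {e e′} → Joins G v y e → Joins G v z e′ → e ≢ e′
  apart j j′ refl with joins-unique j j′
  ... | inj₁ (_ , y≡z) = y≢z y≡z
  ... | inj₂ (_ , y≡v) = y≢v′ y≡v
  positive : ∀ e {x} → Joins G v x e → 1 ≤ incid v (ends G e)
  positive e j = n≢0⇒n>0 (touches⇒incid v (ends G e) (touches-joinsˡ (ends G e) j))

next-next≢ : ∀ {j} (i : Fin (suc (suc (suc j)))) → next (next i) ≢ i
next-next≢ i eq with toℕ-next i | toℕ-next (next i)
... | inj₁ (_ , p) | inj₁ (_ , q) = contradiction (trans (sym (cong toℕ eq)) (trans q (cong suc p))) (<⇒≢ (m<n⇒m<1+n (n<1+n _)))
... | inj₁ (_ , p) | inj₂ (a , q) = contradiction (trans (sym a) (trans p (cong suc (trans (sym (cong toℕ eq)) q)))) λ ()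
... | inj₂ (a , p) | inj₁ (_ , q) = contradiction (trans (sym a) (trans (sym (cong toℕ eq)) (trans q (cong suc p)))) λ ()
... | inj₂ (_ , p) | inj₂ (b , _) = contradiction (trans (sym b) p) λ ()

even⇒2* : ∀ k → odd k ≡ false → ∃ λ h → k ≡ 2 * h
even⇒2* zero _ = 0 , refl
even⇒2* (suc (suc k)) even with h , refl ← even⇒2* k (trans (sym (not-involutive (odd k))) even) =
  suc h , cong suc (sym (+-suc h (h + 0)))

-- The walk that never turns back

module Walk (G : Graph) (linked : Linked G) (v₀ : Fin (n G)) (nbrs : ∀ v → TwoNeighbours G v) where

  private module N v = TwoNeighbours (nbrs v)

  Adj : Fin (n G) → Fin (n G) → Set
  Adj x y = y ≡ N.l x ⊎ y ≡ N.r x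

  pair : ∀ {x y} → Adj x y → ∃₂ λ e e′ → e ≢ e′ × Joins G x y e × Joins G x y e′ × (∀ f → Joins G x y f → f ≡ e ⊎ f ≡ e′)
  pair {x} (inj₁ refl) = N.el x , N.el′ x , N.el≢el′ x , N.el-joins x , N.el′-joins x , exact
    where
    wrong : ∀ {f} → Joins G x (N.l x) f → ¬ Joins G x (N.r x) f
    wrong j j′ with joins-unique j j′
    ... | inj₁ (_ , eq) = N.l≢r x eq
    ... | inj₂ (_ , eq) = N.l≢v x eq
    exact : ∀ f → Joins G x (N.l x) f → f ≡ N.el x ⊎ f ≡ N.el′ x
    exact f j with N.only x f (touches-joinsˡ (ends G f) j)
    ... | inj₁ known = known
    ... | inj₂ (inj₁ refl) = contradiction (N.er-joins x) (wrong j)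
    ... | inj₂ (inj₂ refl) = contradiction (N.er′-joins x) (wrong j)
  pair {x} (inj₂ refl) = N.er x , N.er′ x , N.er≢er′ x , N.er-joins x , N.er′-joins x , exact
    where
    wrong : ∀ {f} → Joins G x (N.r x) f → ¬ Joins G x (N.l x) f
    wrong j j′ with joins-unique j j′
    ... | inj₁ (_ , eq) = N.l≢r x (sym eq)
    ... | inj₂ (_ , eq) = N.r≢v x eq
    exact : ∀ f → Joins G x (N.r x) f → f ≡ N.er x ⊎ f ≡ N.er′ x
    exact f j with N.only x f (touches-joinsˡ (ends G f) j)
    ... | inj₂ known = known
    ... | inj₁ (inj₁ refl) = contradiction (N.el-joins x) (wrong j)
    ... | inj₁ (inj₂ refl) = contradiction (N.el′-joins x) (wrong j)

  adj-irrefl : ∀ {x y} → Adj x y → y ≢ x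
  adj-irrefl {x} (inj₁ refl) = N.l≢v x
  adj-irrefl {x} (inj₂ refl) = N.r≢v x

  joins⇒adj : ∀ {x y e} → Joins G x y e → Adj x y
  joins⇒adj {x} {y} {e} j with N.only x e (touches-joinsˡ (ends G e) j)
  ... | inj₁ (inj₁ refl) = Sum.map proj₂ (λ (p , q) → contradiction (sym p) (N.l≢v x)) (joins-unique j (N.el-joins x))
  ... | inj₁ (inj₂ refl) = Sum.map proj₂ (λ (p , q) → contradiction (sym p) (N.l≢v x)) (joins-unique j (N.el′-joins x))
  ... | inj₂ (inj₁ refl) = inj₂ (fromInj₁ (λ (p , q) → contradiction (sym p) (N.r≢v x)) (Sum.map₁ proj₂ (joins-unique j (N.er-joins x))))
  ... | inj₂ (inj₂ refl) = inj₂ (fromInj₁ (λ (p , q) → contradiction (sym p) (N.r≢v x)) (Sum.map₁ proj₂ (joins-unique j (N.er′-joins x))))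

  adj-sym : ∀ {x y} → Adj x y → Adj y x
  adj-sym a with _ , _ , _ , j , _ ← pair a = joins⇒adj (joins-sym j)

  adj-two : ∀ {x a b c} → Adj x a → Adj x b → a ≢ b → Adj x c → c ≡ a ⊎ c ≡ b
  adj-two (inj₁ refl) (inj₁ refl) a≢b _ = contradiction refl a≢b
  adj-two (inj₂ refl) (inj₂ refl) a≢b _ = contradiction refl a≢b
  adj-two (inj₁ refl) (inj₂ refl) _ c = c
  adj-two (inj₂ refl) (inj₁ refl) _ (inj₁ c) = inj₂ c
  adj-two (inj₂ refl) (inj₁ refl) _ (inj₂ c) = inj₁ c

  other : Fin (n G) → Fin (n G) → Fin (n G)
  other x y = if y == N.l x then N.r x else N.l x

  other-adj : ∀ x y → Adj x (other x y)
  other-adj x y with y == N.l x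
  ... | true  = inj₂ refl
  ... | false = inj₁ refl

  other≢ : ∀ x y → other x y ≢ y
  other≢ x y eq with y ≟ N.l x
  ... | yes refl = N.l≢r x (sym eq)
  ... | no y≢l = y≢l (sym eq)

  s : ℕ → Fin (n G)
  s 0             = v₀
  s 1             = N.r v₀
  s (suc (suc k)) = other (s (suc k)) (s k)

  s-adj : ∀ k → Adj (s k) (s (suc k))
  s-adj zero    = inj₂ refl
  s-adj (suc k) = other-adj (s (suc k)) (s k)

  s-turn : ∀ k → s (suc (suc k)) ≢ s k
  s-turn k = other≢ (s (suc k)) (s k)

  Distinct : ℕ → Set
  Distinct j = ∀ {a b} → a < j → b < j → s a ≡ s b → a ≡ b

  Return : Set
  Return = ∃ λ j → Distinct j × ∃ λ i → i < j × s i ≡ s j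

  distinct-or-return : ∀ j → Distinct j ⊎ Return
  distinct-or-return zero = inj₁ λ ()
  distinct-or-return (suc j) with distinct-or-return j
  ... | inj₂ ret = inj₂ ret
  ... | inj₁ dist with any? (λ (i : Fin j) → s (toℕ i) ≟ s j)
  ...   | yes (i , eq) = inj₂ (j , dist , toℕ i , Fin.toℕ<n i , eq)
  ...   | no none = inj₁ dist′
    where
    new : ∀ {a} → a < j → s a ≢ s j
    new a<j eq = none (fromℕ< a<j , trans (cong s (Fin.toℕ-fromℕ< a<j)) eq)
    dist′ : Distinct (suc j)
    dist′ a< b< eq with m<1+n⇒m<n∨m≡n a< | m<1+n⇒m<n∨m≡n b<
    ... | inj₁ a<j  | inj₁ b<j  = dist a<j b<j eq
    ... | inj₁ a<j  | inj₂ refl = contradiction eq (new a<j)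
    ... | inj₂ refl | inj₁ b<j  = contradiction (sym eq) (new b<j)
    ... | inj₂ refl | inj₂ refl = refl

  return : Return
  return with distinct-or-return (suc (n G))
  ... | inj₂ ret = ret
  ... | inj₁ dist = contradiction (Fin.injective⇒≤ {f = s ∘ toℕ} λ {x} {y} eq → Fin.toℕ-injective (dist (Fin.toℕ<n x) (Fin.toℕ<n y) eq))
                                  (<-irrefl refl)

  -- If the first repetition hit a later vertex of the walk, the vertex just before it would be one
  -- of the two neighbours already placed around that vertex; the walk would have repeated earlier,
  -- stood still or turned back.
  return-to-start : ∀ {j i} → Distinct j → i < j → s i ≡ s j → i ≡ 0
  return-to-start {i = zero} _ _ _ = refl
  return-to-start {suc j} {suc i} dist i<j eq
    with adj-two (adj-sym (s-adj i)) (s-adj (suc i)) (s-turn i ∘ sym) (subst (λ x → Adj x (s j)) (sym eq) (adj-sym (s-adj j)))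
  ... | inj₁ sj≡si = contradiction (dist (n<1+n j) (<-trans (n<1+n i) i<j) sj≡si) (<⇒≢ (s≤s⁻¹ i<j) ∘ sym)
  ... | inj₂ sj≡si+2 with m<1+n⇒m<n∨m≡n i<j
  ...   | inj₂ refl = contradiction (sym eq) (adj-irrefl (s-adj (suc i)))
  ...   | inj₁ i<j′ with refl ← dist (n<1+n j) (s≤s i<j′) sj≡si+2 = contradiction (sym eq) (s-turn (suc i))

  module Cycle (K : ℕ) (dist : Distinct (suc (suc (suc K)))) (closes : s 0 ≡ s (suc (suc (suc K)))) where

    L : ℕ
    L = suc (suc (suc K))

    vto : Fin L → Fin (n G)
    vto i = s (toℕ i)

    vto-inj : ∀ {i j} → vto i ≡ vto j → i ≡ j
    vto-inj {i} {j} eq = Fin.toℕ-injective (dist (Fin.toℕ<n i) (Fin.toℕ<n j) eq)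

    vto-next : ∀ i → vto (next i) ≡ s (suc (toℕ i))
    vto-next i with toℕ-next i
    ... | inj₁ (_ , eq) = cong s eq
    ... | inj₂ (last , eq) = trans (cong s eq) (trans closes (cong (s ∘ suc) (sym last)))

    vto-adj : ∀ i → Adj (vto i) (vto (next i))
    vto-adj i = subst (Adj (vto i)) (sym (vto-next i)) (s-adj (toℕ i))

    neighbours : ∀ i {y} → Adj (vto (next i)) y → y ≡ vto i ⊎ y ≡ vto (next (next i))
    neighbours i = adj-two (adj-sym (vto-adj i)) (vto-adj (next i)) λ eq → next-next≢ i (sym (vto-inj eq))

    reached? : ∀ x → Dec (∃ λ i → vto i ≡ x)
    reached? x = any? λ i → vto i ≟ x

    reached-adj : ∀ {x y} → Adj x y → (∃ λ i → vto i ≡ x) → ∃ λ i → vto i ≡ y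
    reached-adj a (i , refl) with i′ , refl ← next-surjective i with neighbours i′ a
    ... | inj₁ refl = i′ , refl
    ... | inj₂ refl = next (next i′) , refl

    -- Both neighbours of a vertex on the cycle lie on the cycle, so no edge leaves the set of
    -- visited vertices.
    vto-onto : ∀ x → ∃ λ i → vto i ≡ x
    vto-onto x with reached? x | linked (isYes ∘ reached?) closed x (vto zero)
      where
      closed : ∀ e → cross (isYes ∘ reached?) (ends G e) ≡ false
      closed e with reached? (proj₁ (ends G e)) | reached? (proj₂ (ends G e))
      ... | yes _ | yes _ = refl
      ... | no _  | no _  = refl
      ... | yes p | no ¬q = contradiction (reached-adj (joins⇒adj {e = e} (inj₁ refl)) p) ¬q
      ... | no ¬p | yes q = contradiction (reached-adj (joins⇒adj {e = e} (inj₂ refl)) q) ¬p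
    ... | yes found | _ = found
    ... | no _ | same with reached? (vto zero)
    ...   | yes _ = contradiction same λ ()
    ...   | no ¬start = contradiction (zero , refl) ¬start

    E E′ : Fin L → Fin (m G)
    E i  = proj₁ (pair (vto-adj i))
    E′ i = proj₁ (proj₂ (pair (vto-adj i)))

    E-joins : ∀ i → Joins G (vto i) (vto (next i)) (E i)
    E-joins i = proj₁ (proj₂ (proj₂ (proj₂ (pair (vto-adj i)))))

    E′-joins : ∀ i → Joins G (vto i) (vto (next i)) (E′ i)
    E′-joins i = proj₁ (proj₂ (proj₂ (proj₂ (proj₂ (pair (vto-adj i))))))

    E-onto : ∀ i e → Joins G (vto i) (vto (next i)) e → e ≡ E i ⊎ e ≡ E′ i
    E-onto i = proj₂ (proj₂ (proj₂ (proj₂ (proj₂ (pair (vto-adj i))))))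

    -- An edge shared by two positions could only be traversed in opposite directions, which
    -- requires a cycle of length two.
    position : ∀ i j {e e′} → Joins G (vto i) (vto (next i)) e → Joins G (vto j) (vto (next j)) e′ → e ≡ e′ → i ≡ j
    position i j p q refl with joins-unique p q
    ... | inj₁ (eq , _) = vto-inj eq
    ... | inj₂ (eq , eq′) = contradiction (trans (cong next (sym (vto-inj {i} {next j} eq))) (vto-inj {next i} {j} eq′)) (next-next≢ j)

    eto : Fin (L + L) → Fin (m G)
    eto = E Vector.++ E′

    eto-inj : ∀ {x y} → eto x ≡ eto y → x ≡ y
    eto-inj = ++-injective (λ {i} {j} → position i j (E-joins i) (E-joins j)) (λ {i} {j} → position i j (E′-joins i) (E′-joins j)) apart
      where
      apart : ∀ i j → E i ≢ E′ j
      apart i j eq with refl ← position i j (E-joins i) (E′-joins j) eq = proj₁ (proj₂ (proj₂ (pair (vto-adj i)))) eq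

    eto-at : ∀ i e → Joins G (vto i) (vto (next i)) e → ∃ λ x → eto x ≡ e
    eto-at i e j with E-onto i e j
    ... | inj₁ refl = i ↑ˡ L , ++-↑ˡ E E′ i
    ... | inj₂ refl = L ↑ʳ i , ++-↑ʳ E E′ i

    eto-onto : ∀ e → ∃ λ x → eto x ≡ e
    eto-onto e = from-ends (inj₁ refl)
      where
      from-ends : ∀ {x y} → Joins G x y e → ∃ λ x → eto x ≡ e
      from-ends {x} {y} j with vto-onto x
      ... | i , refl with next-surjective i
      ...   | i′ , refl with neighbours i′ (joins⇒adj j)
      ...     | inj₁ refl = eto-at i′ e (joins-sym j)
      ...     | inj₂ refl = eto-at (next i′) e j

    pres : ∀ e → SameEnds (ends G (eto e)) (map vto vto (ends (doubleCycle (suc (suc K))) e))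
    pres e with splitAt L e
    ... | inj₁ i = E-joins i
    ... | inj₂ i = E′-joins i

    cycle-iso : Iso (doubleCycle (suc (suc K))) G
    cycle-iso = record { vmap = bijection vto vto-inj vto-onto ; emap = bijection eto eto-inj eto-onto ; ends-pres = pres }

  isDoubleCycle : ∃ λ K → Iso (doubleCycle K) G
  isDoubleCycle with j , dist , i , i<j , eq ← return with refl ← return-to-start dist i<j eq with j
  -- Length one would mean standing still and length two turning back; length zero is excluded by
  -- `i<j`.
  ... | 1 = contradiction (sym eq) (adj-irrefl (s-adj 0))
  ... | 2 = contradiction (sym eq) (s-turn 0)
  ... | suc (suc (suc K)) = suc (suc K) , Cycle.cycle-iso K dist eq

-- Assembling the classification

doubleCycle-InC : ∀ {G K} → odd (n G) ≡ true → Iso (doubleCycle K) G → InC G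
doubleCycle-InC {G} {K} odd-n i = even (even⇒2* K even-K) i
  where
  even-K : odd K ≡ false
  even-K = trans (sym (not-involutive (odd K))) (cong not (trans (cong odd (Perm.↔⇒≡ (Iso.vmap i))) odd-n))
  even : (∃ λ h → K ≡ 2 * h) → Iso (doubleCycle K) G → InC G
  even (h , refl) = iso (oddDC h)

-- The walk needs two distinct neighbours, so this cycle is treated apart: each loop adds two to the
-- degree, hence there are two loops.
one-vertex-InC : ∀ G → n G ≡ 1 → Regular 4 G → InC G
one-vertex-InC (mkGraph 1 m ends) refl reg = loops m ends (trans (sym (sumFin-cong m λ e → all-loops (ends e))) (reg zero))
  where
  all-loops : ∀ p → incid {1} zero p ≡ 2
  all-loops (zero , zero) = refl
  loops : ∀ m ends → sumFin m (λ _ → 2) ≡ 4 → InC (mkGraph 1 m ends)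
  loops 2 ends _ = iso (oddDC 0) record
    { vmap = Inv.↔-refl ; emap = Inv.↔-refl ; ends-pres = λ e → inj₁ (unique _ _) }
    where
    unique : (p q : Fin 1 × Fin 1) → p ≡ q
    unique (zero , zero) (zero , zero) = refl

odd-case : ∀ G → Regular 4 G → Linked G → odd (n G) ≡ true → Colorable 3 1 G ⊎ (OddCut G ⊎ InC G)
odd-case G reg linked odd-n with single-or-mates G
... | inj₁ (u , v , f , u≢v , only) = Sum.map₂ inj₁ (single-edge⇒colourable⊎cut G reg odd-n u≢v only)
... | inj₂ mates = inj₂ (sizes (n G) refl)
  where
  sizes : ∀ k → n G ≡ k → OddCut G ⊎ InC G
  sizes 0 eq = contradiction (trans (sym odd-n) (cong odd eq)) λ ()
  sizes 1 eq = inj₂ (one-vertex-InC G eq reg)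
  sizes (suc (suc k)) eq with ∀-⊎ (λ v → two-neighbours G reg mates linked v (another v))
    where
    another′ : ∀ {k l} → l ≡ suc (suc k) → (v : Fin l) → ∃ λ u → u ≢ v
    another′ refl zero    = suc zero , λ ()
    another′ refl (suc v) = zero , λ ()
    another : ∀ v → ∃ λ u → u ≢ v
    another = another′ eq
  ... | inj₁ cut = inj₁ cut
  ... | inj₂ nbrs = inj₂ (doubleCycle-InC odd-n (proj₂ (Walk.isDoubleCycle G linked (subst Fin (sym eq) zero) nbrs)))

-- Stated as a disjunction, so that the recursion can hand back a colouring of a part and extend it,
-- which a statement about uncolourable graphs alone would not provide.
classification : ∀ G → Regular 4 G → Linked G → odd (n G) ≡ true → Colorable 3 1 G ⊎ InC G
classification G = go G (<-wellFounded (n G))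
  where
  go : ∀ G → Acc _<_ (n G) → Regular 4 G → Linked G → odd (n G) ≡ true → Colorable 3 1 G ⊎ InC G
  go G (acc rec) reg linked odd-n with odd-case G reg linked odd-n
  ... | inj₁ col = inj₁ col
  ... | inj₂ (inj₂ inC) = inj₂ inC
  ... | inj₂ (inj₁ cut) = adhesion-step reg linked (CutDecomposition.decomposition G reg linked odd-n cut)
                            λ H H<G → go H (rec H<G)

theorem3 : (G : Graph) → Connected G → Regular 4 G → ((¬ Colorable 3 1 G) ⇔ InC G)
theorem3 G conn reg = mk⇔ to InC⇒¬colorable
  where
  linked : Linked G
  linked = connected⇒linked G conn
  to : ¬ Colorable 3 1 G → InC G
  to ¬col with odd (n G) in parity
  ... | false = contradiction (even-colourable G linked reg parity (fromℕ< (proj₁ conn))) ¬col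
  ... | true  = fromInj₂ (λ col → contradiction col ¬col) (classification G reg linked parity)
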